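{- Let $G=(V,E)$ be a finite connected undirected graph with probability weights $w:E\to\mathbb{R}_{>0}$ and degree weights $\omega:E\to\mathbb{R}$, and let $r\in V$ be arbitrary. Let $T$ be a random spanning tree of $G$ with $\Pr(T)\propto\prod_{e\in E_T}w(e)$. For a node $v\in V$, $$\mathbb{E}\big[\deg^{\omega}_T(v)\big]=\operatorname{Tr}\Big[\big(L^{(1)}_v\big)^{[r]}\big(L_G^{[r]}\big)^{ -1}\Big],$$ $$\operatorname{Var}\big[\deg^{\omega}_T(v)\big]=\operatorname{Tr}\Big[\Big(\big(L^{(2)}_v\big)^{[r]}-\big(L^{(1)}_v\big)^{[r]}\big(L_G^{[r]}\big)^{ -1}\big(L^{(1)}_v\big)^{[r]}\Big)\big(L_G^{[r]}\big)^{ -1}\Big].$$ Moreover, for a second node $u\in V$, $u\neq v$, $$\operatorname{Cov}\big(\deg^{\omega}_T(v),\deg^{\omega}_T(u)\big)=\operatorname{Tr}\Big[\Big(\big(L^{(2)}_{vu}\big)^{[r]}-\big(L^{(1)}_v\big)^{[r]}\big(L_G^{[r]}\big)^{ -1}\big(L^{(1)}_u\big)^{[r]}\Big)\big(L_G^{[r]}\big)^{ -1}\Big].$$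
   Context: For an edge weight function $c:E\to\mathbb{R}$ on $G$, its Laplacian is $L=D-A$ where $A_{ij}=c(\{i,j\})$ (zero if $\{i,j\}\notin E$) and $D$ is diagonal with $D_{ii}=\sum_j A_{ij}$. $L_G$ is the Laplacian for the weights $w$. For a node $v$ and $p\in\{1,2\}$, $L^{(p)}_v$ is the Laplacian for the weights $c(e)=w(e)\omega(e)^p$ if $v\in e$ and $c(e)=0$ otherwise (i.e. only edges incident to $v$ kept, with weights scaled by $\omega^p$). $L^{(2)}_{vu}$ is the Laplacian for the weights $c(\{u,v\})=w(\{u,v\})\omega(\{u,v\})^2$ and $c(e)=0$ for all other edges (the zero matrix if $\{u,v\}\notin E$). For a matrix $M$ indexed by $V$, $M^{[r]}$ is $M$ with the row and column indexed by $r$ removed. The weighted degree of $v$ in $T$ is $\deg^{\omega}_T(v)=\sum_{e\in E_T,\, v\in e}\omega(e)$, and $\operatorname{Tr}$ is the trace. -}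

module Defs where

open import Level using (_⊔_) renaming (suc to lsuc)
open import Algebra.Apartness.Bundles using (HeytingField)
open import Algebra.Bundles using (CommutativeRing; Semiring)
import Algebra.Definitions.RawMonoid as RawMonoidOps
import Algebra.Definitions.RawSemiring as RawSemiringOps
open import Data.Bool.Base using (if_then_else_; _∧_)
open import Data.Fin.Base using (Fin; zero; suc; fromℕ; inject₁; punchIn)
open import Data.Fin.Properties using (any?) renaming (_≟_ to _≟ᶠ_)
open import Data.Fin.Subset using (Subset; inside; outside; ⊤; _∈_)
open import Data.Fin.Subset.Properties using (_∈?_)
open import Data.Nat.Base as ℕ using (ℕ; zero; suc)
open import Data.Product.Base using (∃-syntax; _×_; _,_; proj₁; proj₂)
open import Data.Product.Properties using (≡-dec)
open import Data.Sum.Base using (_⊎_)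
open import Data.Vec.Base using ([]; _∷_)
open import Function.Definitions using (Injective)
open import Relation.Binary.Construct.Closure.ReflexiveTransitive using (Star)
open import Relation.Binary.Core using (Rel)
open import Relation.Binary.PropositionalEquality.Core using (_≡_)
open import Relation.Binary.Structures using (IsStrictPartialOrder)
open import Relation.Nullary using (¬_; Dec; yes; no; does)
open import Relation.Nullary.Decidable using (_⊎-dec_)

-- The real numbers, axiomatised as an Archimedean, Cauchy-complete ordered
-- field.  The order is the strict one, with x # y meaning x < y or y < x, so
-- that constructive reals are a model as well; x ≤ y is ¬ (y < x).
record RealField c ℓ₁ ℓ₂ ℓ₃ : Set (lsuc (c ⊔ ℓ₁ ⊔ ℓ₂ ⊔ ℓ₃)) where
  field
    heytingField : HeytingField c ℓ₁ ℓ₂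

  open HeytingField heytingField public

  commutativeRing : CommutativeRing c ℓ₁
  commutativeRing = record { isCommutativeRing = isCommutativeRing }

  open CommutativeRing commutativeRing public
    using (+-rawMonoid; *-rawMonoid; semiring)

  open Semiring semiring public
    using (rawSemiring)

  open RawMonoidOps +-rawMonoid public
    using (sum) renaming (_×_ to _·_)
  open RawMonoidOps *-rawMonoid public
    using () renaming (sum to product)
  open RawSemiringOps rawSemiring public
    using (_^_)

  infix 4 _<_ _≤_

  field
    _<_                  : Rel Carrier ℓ₃
    isStrictPartialOrder : IsStrictPartialOrder _≈_ _<_
    #⇒<⊎>                : ∀ {x y} → x # y → x < y ⊎ y < x
    <⇒#                  : ∀ {x y} → x < y → x # y
    +-monoˡ-<            : ∀ z {x y} → x < y → x + z < y + z
    *-pos                : ∀ {x y} → 0# < x → 0# < y → 0# < x * y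
    archimedean          : ∀ x → ∃[ n ] x < n · 1#

  _≤_ : Rel Carrier ℓ₃
  x ≤ y = ¬ (y < x)

  Within : Carrier → Rel Carrier ℓ₃
  Within ε x y = (x - y < ε) × (y - x < ε)

  Cauchy : (ℕ → Carrier) → Set (c ⊔ ℓ₃)
  Cauchy s = ∀ ε → 0# < ε →
    ∃[ N ] (∀ m n → N ℕ.≤ m → N ℕ.≤ n → Within ε (s m) (s n))

  ConvergesTo : (ℕ → Carrier) → Carrier → Set (c ⊔ ℓ₃)
  ConvergesTo s l = ∀ ε → 0# < ε →
    ∃[ N ] (∀ n → N ℕ.≤ n → Within ε (s n) l)

  field
    complete : ∀ s → Cauchy s → ∃[ l ] ConvergesTo s l

-- A finite simple undirected graph on Fin n.  Edges are enumerated by Fin size;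
-- `ends` lists the endpoints of an edge in an arbitrary order that nothing
-- below depends on, and `simple` identifies an edge with its pair of endpoints.
record Graph (n : ℕ) : Set where
  field
    size : ℕ
    ends : Fin size → Fin n × Fin n

  Vertex : Set
  Vertex = Fin n

  Edge : Set
  Edge = Fin size

  Joins : Edge → Vertex → Vertex → Set
  Joins e u v = ends e ≡ (u , v) ⊎ ends e ≡ (v , u)

  field
    loopless : ∀ e v → ¬ Joins e v v
    simple   : ∀ {e f u v} → Joins e u v → Joins f u v → e ≡ f

  joins? : ∀ e u v → Dec (Joins e u v)
  joins? e u v =
    ≡-dec _≟ᶠ_ _≟ᶠ_ (ends e) (u , v) ⊎-dec ≡-dec _≟ᶠ_ _≟ᶠ_ (ends e) (v , u)

  Incident : Vertex → Edge → Set
  Incident v e = v ≡ proj₁ (ends e) ⊎ v ≡ proj₂ (ends e)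

  incident? : ∀ v e → Dec (Incident v e)
  incident? v e = (v ≟ᶠ proj₁ (ends e)) ⊎-dec (v ≟ᶠ proj₂ (ends e))

module Subgraphs {n : ℕ} (G : Graph n) where
  open Graph G

  -- An edge set S stands for the spanning subgraph (V , S).
  EdgeSet : Set
  EdgeSet = Subset size

  Adjacent : EdgeSet → Vertex → Vertex → Set
  Adjacent S u v = ∃[ e ] (e ∈ S × Joins e u v)

  ConnectedBy : EdgeSet → Set
  ConnectedBy S = ∀ u v → Star (Adjacent S) u v

  Connected : Set
  Connected = ConnectedBy ⊤

  -- A cycle: at least three distinct vertices, cyclically adjacent.
  record Cycle (S : EdgeSet) : Set where
    field
      k         : ℕ
      vertex    : Fin (3 ℕ.+ k) → Vertex
      injective : Injective _≡_ _≡_ vertex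
      step      : ∀ i → Adjacent S (vertex (inject₁ i)) (vertex (suc i))
      close     : Adjacent S (vertex (fromℕ (2 ℕ.+ k))) (vertex zero)

  SpanningTree : EdgeSet → Set
  SpanningTree S = ConnectedBy S × ¬ Cycle S

module Matrices {c ℓ₁ ℓ₂ ℓ₃} (ℝ : RealField c ℓ₁ ℓ₂ ℓ₃) where
  open RealField ℝ

  Matrix : ℕ → Set c
  Matrix n = Fin n → Fin n → Carrier

  infixl 7 _⊗_
  infixl 6 _⊖_
  infix  4 _≋_

  _≋_ : ∀ {n} → Matrix n → Matrix n → Set ℓ₁
  M ≋ N = ∀ i j → M i j ≈ N i j

  _⊖_ : ∀ {n} → Matrix n → Matrix n → Matrix n
  (M ⊖ N) i j = M i j - N i j

  _⊗_ : ∀ {n} → Matrix n → Matrix n → Matrix n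
  (M ⊗ N) i j = sum λ k → M i k * N k j

  diagonal : ∀ {n} → (Fin n → Carrier) → Matrix n
  diagonal d i j = if does (i ≟ᶠ j) then d i else 0#

  identity : ∀ {n} → Matrix n
  identity = diagonal λ _ → 1#

  Tr : ∀ {n} → Matrix n → Carrier
  Tr M = sum λ i → M i i

  IsInverse : ∀ {n} → Matrix n → Matrix n → Set ℓ₁
  IsInverse M N = (M ⊗ N ≋ identity) × (N ⊗ M ≋ identity)

  infix 9 _[_]

  _[_] : ∀ {n} → Matrix (suc n) → Fin (suc n) → Matrix n
  (M [ r ]) i j = M (punchIn r i) (punchIn r j)

module Weighted {c ℓ₁ ℓ₂ ℓ₃} (ℝ : RealField c ℓ₁ ℓ₂ ℓ₃) {n : ℕ} (G : Graph n) where
  open RealField ℝ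
  open Matrices ℝ public
  open Graph G
  open Subgraphs G public

  adjacency : (Edge → Carrier) → Matrix n
  adjacency c i j with any? (λ e → joins? e i j)
  ... | yes (e , _) = c e
  ... | no  _       = 0#

  laplacian : (Edge → Carrier) → Matrix n
  laplacian c = diagonal (λ i → sum (adjacency c i)) ⊖ adjacency c

  -- vertexLaplacian w ω p v is L_v^(p); pairLaplacian w ω v u is L_vu^(2).
  vertexLaplacian : (w ω : Edge → Carrier) → ℕ → Vertex → Matrix n
  vertexLaplacian w ω p v =
    laplacian λ e → if does (incident? v e) then w e * ω e ^ p else 0#

  pairLaplacian : (w ω : Edge → Carrier) → Vertex → Vertex → Matrix n
  pairLaplacian w ω v u =
    laplacian λ e → if does (joins? e v u) then w e * ω e ^ 2 else 0#

  treeWeight : (Edge → Carrier) → EdgeSet → Carrier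
  treeWeight w S = product λ e → if does (e ∈? S) then w e else 1#

  degree : (Edge → Carrier) → Vertex → EdgeSet → Carrier
  degree ω v S =
    sum λ e → if does (e ∈? S) ∧ does (incident? v e) then ω e else 0#

  sumSubsets : ∀ {m} → (Subset m → Carrier) → Carrier
  sumSubsets {zero}  f = f []
  sumSubsets {suc m} f =
    sumSubsets (λ S → f (outside ∷ S)) + sumSubsets (λ S → f (inside ∷ S))

  -- P is the law of a random edge set that is a spanning tree with
  -- probability one, with Pr(T) ∝ ∏_{e ∈ T} w(e).
  record IsSpanningTreeLaw (w : Edge → Carrier) (P : EdgeSet → Carrier)
         : Set (c ⊔ ℓ₁ ⊔ ℓ₃) where
    field
      nonnegative  : ∀ S → 0# ≤ P S
      total        : sumSubsets P ≈ 1#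
      supported    : ∀ S → ¬ SpanningTree S → P S ≈ 0#
      proportional : ∃[ κ ] (∀ S → SpanningTree S → P S ≈ κ * treeWeight w S)

  module Moments (P : EdgeSet → Carrier) where
    𝔼 : (EdgeSet → Carrier) → Carrier
    𝔼 X = sumSubsets λ S → P S * X S

    Cov : (X Y : EdgeSet → Carrier) → Carrier
    Cov X Y = 𝔼 λ S → (X S - 𝔼 X) * (Y S - 𝔼 Y)

    Var : (EdgeSet → Carrier) → Carrier
    Var X = 𝔼 λ S → (X S - 𝔼 X) ^ 2

{-# OPTIONS --safe #-}

-- For a spanning tree T and e ∈ T let χ_{T,e} be the indicator of the component
-- of T − e that contains the first endpoint of e, and let φ_e = 𝔼[1_{e ∈ T} χ_{T,e}],
-- normalised to vanish at r.  Write ∂ψ(f) for the difference of ψ along f.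
-- Exchanging e for f turns a tree T ∋ e with f ∉ T and ∂χ_{T,e}(f) ≠ 0 into a tree
-- T' = T − e + f with ∂χ_{T',f}(e) = ∂χ_{T,e}(f) and w(f) w(T) = w(e) w(T'); hence
-- w(f) ∂φ_e(f) = w(e) ∂φ_f(e).  Together with the decomposition of a path of T into its
-- edges this gives Kirchhoff's law Σ_f w(f) ∂φ_e(f) ∂ψ(f) = w(e) ∂ψ(e).  Consequently
-- Σ_e w(e)⁻¹ φ_e(u) φ_e(v) is the inverse Γ of the reduced Laplacian, and
-- ∂φ_e(f) = w(e) b_eᵀ Γ b_f, where b_e is the signed incidence vector of e.
-- Repeating the argument for the trees through f ≠ e shows
-- Pr(e, f ∈ T) = Pr(e ∈ T) Pr(f ∈ T) − ∂φ_e(f) ∂φ_f(e),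
-- and the moments of the degrees follow by bilinearity.
module Submission where

open import Defs
open import Algebra.Bundles using (CommutativeRing; RawRing)
open import Data.Bool.Base using (Bool; true; false; if_then_else_; _∧_)
open import Data.Empty using (⊥-elim)
open import Data.Fin.Base using (Fin; zero; suc; fromℕ; inject₁; punchIn; punchOut)
open import Data.Fin.Properties
  using (any?; all?; suc-injective; punchInᵢ≢i; punchIn-injective; punchIn-punchOut)
  renaming (_≟_ to _≟ᶠ_)
open import Data.Fin.Subset using (Subset; inside; outside; _∈_; _∉_)
open import Data.Fin.Subset.Properties using (_∈?_)
open import Data.Maybe.Base using (Maybe; just; nothing)
open import Data.Nat.Base as ℕ using (ℕ; zero; suc)
import Data.Nat.Properties as ℕₚ
open import Data.Product.Base using (∃-syntax; Σ-syntax; _×_; _,_; proj₁; proj₂)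
open import Data.Sum.Base using (_⊎_; inj₁; inj₂; swap)
open import Data.Vec.Base using ([]; _∷_; here; there; lookup; _[_]≔_)
open import Data.Vec.Properties
  using ([]≔-updates; []≔-minimal; []≔-idempotent; []≔-lookup; []=-injective)
open import Function.Base using (_∘_; id)
open import Function.Definitions using (Injective)
open import Level using (0ℓ; _⊔_)
open import Relation.Binary.Construct.Closure.ReflexiveTransitive
  using (Star; ε; _◅_; _◅◅_; gmap; reverse)
import Relation.Binary.Construct.Closure.ReflexiveTransitive as Star
open import Relation.Binary.Core using (Rel)
open import Relation.Binary.PropositionalEquality.Core as ≡ using (_≡_; _≢_)
open import Relation.Nullary using (¬_; Dec; yes; no; does)
open import Relation.Nullary.Decidable
  using (map′; _×-dec_; _⊎-dec_; _→-dec_; ¬?; dec-true; dec-false)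

-- Neither determinants nor the matrix-tree theorem enter: the inverse of the reduced Laplacian is
-- written down and verified. All probability rests on one exchange identity, `reciprocity`. It
-- carries a random factor `γ`, so that it serves both for single edges (`γ` constantly 1) and for
-- the trees through f (`γ` the indicator of f). In the second case the exchange of e for f itself
-- changes `γ`; this single failure leaves one correction term, and that term is the whole
-- covariance of two distinct edges. Equality of reals is not assumed decidable, so every case
-- distinction is made on finite combinatorial data: acyclicity is restated as each edge being a
-- bridge, which `linked?` decides. That an exchange preserves acyclicity is shown by linear
-- algebra, in terms of circulations, which avoids rerouting walks.

-- A ring solver whose coefficients are formal differences m − n of naturals,
-- so that cancellation is decided without deciding equality in R.
module RingSolver {c ℓ} (R : CommutativeRing c ℓ) where
  open CommutativeRing R
  open import Algebra.Properties.Ring ring using (-‿distribˡ-*; -‿distribʳ-*)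
  open import Algebra.Properties.Group +-group using (⁻¹-involutive; ε⁻¹≈ε)
  open import Algebra.Properties.AbelianGroup +-abelianGroup using (⁻¹-∙-comm; ⁻¹-anti-homo‿-)
  open import Algebra.Properties.Semiring.Mult semiring using (×1-homo-*; ×-homo-+)
    renaming (_×_ to _·_)
  open import Algebra.Solver.Ring.AlmostCommutativeRing
    using (fromCommutativeRing; _-Raw-AlmostCommutative⟶_)
  open import Relation.Binary.Reasoning.Setoid setoid
  import Algebra.Solver.Ring.NaturalCoefficients.Default commutativeSemiring as Natural

  differences : RawRing 0ℓ 0ℓ
  differences = record
    { Carrier = ℕ × ℕ
    ; _≈_     = _≡_
    ; _+_     = λ (a , b) (c , d) → a ℕ.+ c , b ℕ.+ d
    ; _*_     = λ (a , b) (c , d) → a ℕ.* c ℕ.+ b ℕ.* d , a ℕ.* d ℕ.+ b ℕ.* c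
    ; -_      = λ (a , b) → b , a
    ; 0#      = 0 , 0
    ; 1#      = 1 , 0
    }

  value : ℕ × ℕ → Carrier
  value (a , b) = a · 1# - b · 1#

  value-* : ∀ p q → value (RawRing._*_ differences p q) ≈ value p * value q
  value-* (a , b) (c , d) = begin
    (a ℕ.* c ℕ.+ b ℕ.* d) · 1# - (a ℕ.* d ℕ.+ b ℕ.* c) · 1#
      ≈⟨ +-cong (split a c b d) (trans (-‿cong (split a d b c)) (sym (⁻¹-∙-comm _ _))) ⟩
    (A * C + B * D) + (- (A * D) + - (B * C))
      ≈⟨ +-cong (+-congˡ (trans (sym (⁻¹-involutive _))
                           (trans (-‿cong (-‿distribˡ-* B D)) (-‿distribʳ-* (- B) D))))
                (+-cong (-‿distribʳ-* A D) (-‿distribˡ-* B C)) ⟩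
    (A * C + (- B) * (- D)) + (A * (- D) + (- B) * C)
      -- With `- B` and `- D` as atoms no subtraction is left, and the semiring solver suffices.
      ≈⟨ Natural.solve 4 (λ a b c d → ((a :* c) :+ (b :* d)) :+ ((a :* d) :+ (b :* c))
           := (a :+ b) :* (c :+ d)) refl A (- B) C (- D) ⟩
    (A - B) * (C - D) ∎
    where
    open Natural using (_:+_; _:*_; _:=_)
    A = a · 1#
    B = b · 1#
    C = c · 1#
    D = d · 1#
    split : ∀ i j k l → (i ℕ.* j ℕ.+ k ℕ.* l) · 1# ≈ (i · 1#) * (j · 1#) + (k · 1#) * (l · 1#)
    split i j k l = trans (×-homo-+ 1# (i ℕ.* j) (k ℕ.* l)) (+-cong (×1-homo-* i j) (×1-homo-* k l))

  interchange : ∀ w x y z → (w + x) - (y + z) ≈ (w - y) + (x - z)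
  interchange w x y z = trans (+-congˡ (sym (⁻¹-∙-comm y z)))
    (Natural.solve 4 (λ w x y z → (w :+ x) :+ (y :+ z) := (w :+ y) :+ (x :+ z)) refl w x (- y) (- z))
    where open Natural using (_:+_; _:=_)

  morphism : differences -Raw-AlmostCommutative⟶ fromCommutativeRing R
  morphism = record
    { ⟦_⟧    = value
    ; +-homo = λ (a , b) (c , d) → trans
        (+-cong (×-homo-+ 1# a c) (-‿cong (×-homo-+ 1# b d))) (interchange _ _ _ _)
    ; *-homo = value-*
    ; -‿homo = λ (a , b) → sym (⁻¹-anti-homo‿- _ _)
    ; 0-homo = -‿inverseʳ 0#
    ; 1-homo = trans (+-cong (+-identityʳ 1#) ε⁻¹≈ε) (+-identityʳ 1#)
    }

  -- Pairs are not normalised, so they are compared by cross-addition. A negative answer proves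
  -- nothing in a ring of unknown characteristic, hence `Maybe`.
  value-≟ : ∀ p q → Maybe (value p ≈ value q)
  value-≟ (a , b) (c , d) with a ℕ.+ d ℕₚ.≟ c ℕ.+ b
  ... | no  _  = nothing
  ... | yes eq = just (begin
    A - B              ≈⟨ +-identityʳ _ ⟨
    (A - B) + 0#       ≈⟨ +-congˡ (-‿inverseʳ D) ⟨
    (A - B) + (D - D)  ≈⟨ interchange A D B D ⟨
    (A + D) - (B + D)  ≈⟨ +-cong A+D≈C+B (-‿cong (+-comm B D)) ⟩
    (C + B) - (D + B)  ≈⟨ interchange C B D B ⟩
    (C - D) + (B - B)  ≈⟨ +-congˡ (-‿inverseʳ B) ⟩
    (C - D) + 0#       ≈⟨ +-identityʳ _ ⟩
    C - D              ∎)
    where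
    A = a · 1#
    B = b · 1#
    C = c · 1#
    D = d · 1#
    A+D≈C+B : A + D ≈ C + B
    A+D≈C+B = begin
      A + D            ≈⟨ ×-homo-+ 1# a d ⟨
      (a ℕ.+ d) · 1#   ≡⟨ ≡.cong (_· 1#) eq ⟩
      (c ℕ.+ b) · 1#   ≈⟨ ×-homo-+ 1# c b ⟩
      C + B            ∎

  open import Algebra.Solver.Ring differences (fromCommutativeRing R) morphism value-≟ public
    using (solve; _:+_; _:*_; _:-_; :-_; _:=_)

-- Walks, cycles and spanning trees

infixl 6 _∖_ _∪_

_∖_ _∪_ : ∀ {m} → Subset m → Fin m → Subset m
S ∖ e = S [ e ]≔ outside
S ∪ e = S [ e ]≔ inside

module _ {m} {S : Subset m} {e : Fin m} where

  ∉-∖ : e ∉ S ∖ e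
  ∉-∖ e∈ with () ← []=-injective e∈ ([]≔-updates S e)

  ∈-∪ : e ∈ S ∪ e
  ∈-∪ = []≔-updates S e

module _ {m} {S : Subset m} {e f : Fin m} where

  ∈-∖⁺ : e ≢ f → e ∈ S → e ∈ S ∖ f
  ∈-∖⁺ = []≔-minimal S e f

  ∈-∪⁺ : e ∈ S → e ∈ S ∪ f
  ∈-∪⁺ e∈S with e ≟ᶠ f
  ... | yes ≡.refl = []≔-updates S e
  ... | no e≢f     = []≔-minimal S e f e≢f e∈S

∈-∪⁻ : ∀ {m} {S : Subset m} {e f} → e ∈ S ∪ f → e ≢ f → e ∈ S
∈-∪⁻ {S = S} {e} {f} e∈ e≢f =
  ≡.subst (e ∈_) (≡.trans ([]≔-idempotent S f) ([]≔-lookup S f))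
    ([]≔-minimal (S ∪ f) e f e≢f e∈)

∈-∖⁻ : ∀ {m} {S : Subset m} {e f} → e ∈ S ∖ f → e ∈ S
∈-∖⁻ {S = S} {e} {f} e∈ with e ≟ᶠ f
... | yes ≡.refl = ⊥-elim (∉-∖ {S = S} e∈)
... | no e≢f     =
  ≡.subst (e ∈_) (≡.trans ([]≔-idempotent S f) ([]≔-lookup S f))
    ([]≔-minimal (S ∖ f) e f e≢f e∈)

∪-∖ : ∀ {m} {S : Subset m} {e} → e ∉ S → S ∪ e ∖ e ≡ S
∪-∖ {S = S} {e} e∉S = ≡.trans ([]≔-idempotent S e)
  (≡.trans (≡.cong (S [ e ]≔_) (≡.sym (lookup-∉ S e e∉S))) ([]≔-lookup S e))
  where
  lookup-∉ : ∀ {m} (S : Subset m) e → e ∉ S → lookup S e ≡ outside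
  lookup-∉ (outside ∷ S) zero    _   = ≡.refl
  lookup-∉ (inside  ∷ S) zero    e∉S = ⊥-elim (e∉S here)
  lookup-∉ (_       ∷ S) (suc e) e∉S = lookup-∉ S e (e∉S ∘ there)

-- `Adjacent` for a bare enumeration of edges, so that `joined?` can recurse on the edges without
-- carrying the laws of a graph.
Joined : ∀ {V : Set} {m} → (Fin m → V × V) → Subset m → Rel V _
Joined ends S u v = ∃[ e ] (e ∈ S × (ends e ≡ (u , v) ⊎ ends e ≡ (v , u)))

-- Adding an edge ab to a graph links u and v exactly when they were linked
-- before or the new edge links their components.
joined? : ∀ {n m} (ends : Fin m → Fin n × Fin n) S u v → Dec (Star (Joined ends S) u v)
joined? ends [] u v = map′ (λ { ≡.refl → ε }) (λ { ε → ≡.refl ; ((() , _) ◅ _) }) (u ≟ᶠ v)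
joined? ends (outside ∷ S) u v = map′ old new (joined? (ends ∘ suc) S u v)
  where
  old = gmap id λ { (e , e∈S , j) → suc e , there e∈S , j }
  new = gmap id λ { (suc e , there e∈S , j) → e , e∈S , j }
joined? {n} ends (inside ∷ S) u v = map′ to from
  (joined? (ends ∘ suc) S u v
    ⊎-dec (joined? (ends ∘ suc) S u a ×-dec joined? (ends ∘ suc) S b v)
    ⊎-dec (joined? (ends ∘ suc) S u b ×-dec joined? (ends ∘ suc) S a v))
  where
  a = proj₁ (ends zero)
  b = proj₂ (ends zero)
  Old New : Rel (Fin n) _
  Old = Star (Joined (ends ∘ suc) S)
  New = Star (Joined ends (inside ∷ S))
  Linked : Rel (Fin n) _
  Linked u v = Old u v ⊎ (Old u a × Old b v) ⊎ (Old u b × Old a v)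
  old : ∀ {u v} → Old u v → New u v
  old = gmap id λ { (e , e∈S , j) → suc e , there e∈S , j }
  to : ∀ {u v} → Linked u v → New u v
  to (inj₁ p)              = old p
  to (inj₂ (inj₁ (p , q))) = old p ◅◅ (zero , here , inj₁ ≡.refl) ◅ old q
  to (inj₂ (inj₂ (p , q))) = old p ◅◅ (zero , here , inj₂ ≡.refl) ◅ old q
  -- Only `q`, the part after the last crossing of the new edge, is kept, so that at most one
  -- crossing remains.
  cross₁ : ∀ {v} → Linked b v → Linked a v
  cross₁ (inj₁ q)              = inj₂ (inj₁ (ε , q))
  cross₁ (inj₂ (inj₁ (_ , q))) = inj₂ (inj₁ (ε , q))
  cross₁ (inj₂ (inj₂ (_ , q))) = inj₁ q
  cross₂ : ∀ {v} → Linked a v → Linked b v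
  cross₂ (inj₁ q)              = inj₂ (inj₂ (ε , q))
  cross₂ (inj₂ (inj₁ (_ , q))) = inj₁ q
  cross₂ (inj₂ (inj₂ (_ , q))) = inj₂ (inj₂ (ε , q))
  prepend : ∀ {u w v} → Joined (ends ∘ suc) S u w → Linked w v → Linked u v
  prepend s (inj₁ p)              = inj₁ (s ◅ p)
  prepend s (inj₂ (inj₁ (p , q))) = inj₂ (inj₁ (s ◅ p , q))
  prepend s (inj₂ (inj₂ (p , q))) = inj₂ (inj₂ (s ◅ p , q))
  from : ∀ {u v} → New u v → Linked u v
  from ε = inj₁ ε
  from ((zero , here , inj₁ ≡.refl) ◅ p) = cross₁ (from p)
  from ((zero , here , inj₂ ≡.refl) ◅ p) = cross₂ (from p)
  from ((suc e , there e∈S , j) ◅ p)     = prepend (e , e∈S , j) (from p)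

module SimplePaths {n r} (R : Rel (Fin n) r) where

  record Path (u v : Fin n) : Set r where
    constructor path
    field
      len       : ℕ
      vertex    : Fin (suc len) → Fin n
      injective : Injective _≡_ _≡_ vertex
      step      : ∀ i → R (vertex (inject₁ i)) (vertex (suc i))
      start     : vertex zero ≡ u
      end       : vertex (fromℕ len) ≡ v

  suffix : ∀ {u v} (p : Path u v) i → Path (Path.vertex p i) v
  suffix (path k p inj step st en) zero = path k p inj step ≡.refl en
  suffix (path (suc k) p inj step st en) (suc i) =
    suffix (path k (p ∘ suc) (suc-injective ∘ inj) (step ∘ suc) ≡.refl en) i

  -- Loop erasure from the back: if the new first vertex already occurs on the simplified rest, the
  -- path restarts at that occurrence.
  simplify : ∀ {u v} → Star R u v → Path u v
  simplify {u} ε =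
    path 0 (λ _ → u) (λ { {zero} {zero} _ → ≡.refl }) (λ ()) ≡.refl ≡.refl
  simplify {u} {v} (s ◅ rest) with simplify rest
  ... | p@(path k vertex inj step st en) with any? (λ i → vertex i ≟ᶠ u)
  ...   | yes (i , eq) = ≡.subst (λ x → Path x v) eq (suffix p i)
  ...   | no u∉p       = path (suc k) vertex′ inj′ step′ ≡.refl en
    where
    vertex′ : Fin (2 ℕ.+ k) → Fin n
    vertex′ zero    = u
    vertex′ (suc i) = vertex i
    inj′ : Injective _≡_ _≡_ vertex′
    inj′ {zero}  {zero}  _  = ≡.refl
    inj′ {zero}  {suc j} eq = ⊥-elim (u∉p (j , ≡.sym eq))
    inj′ {suc i} {zero}  eq = ⊥-elim (u∉p (i , eq))
    inj′ {suc i} {suc j} eq = ≡.cong suc (inj eq)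
    step′ : ∀ i → R (vertex′ (inject₁ i)) (vertex′ (suc i))
    step′ zero    = ≡.subst (R u) (≡.sym st) s
    step′ (suc i) = step i

  chain : ∀ {k} (p : Fin (suc k) → Fin n) → (∀ i → R (p (inject₁ i)) (p (suc i))) →
          Star R (p zero) (p (fromℕ k))
  chain {zero}  p step = ε
  chain {suc k} p step = step zero ◅ chain (p ∘ suc) (step ∘ suc)

module Trees {n} (G : Graph n) where
  open Graph G
  open Subgraphs G

  head tail : Edge → Vertex
  head = proj₁ ∘ ends
  tail = proj₂ ∘ ends

  Linked : EdgeSet → Rel Vertex _
  Linked S = Star (Adjacent S)

  linked? : ∀ S u v → Dec (Linked S u v)
  linked? = joined? ends

  linked-sym : ∀ {S u v} → Linked S u v → Linked S v u
  linked-sym = reverse λ (e , e∈S , j) → e , e∈S , swap j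

  linked-mono : ∀ {S T u v} → (∀ {e} → e ∈ S → e ∈ T) → Linked S u v → Linked T u v
  linked-mono S⊆T = Star.map λ (e , e∈S , j) → e , S⊆T e∈S , j

  edge-linked : ∀ {S e} → e ∈ S → Linked S (head e) (tail e)
  edge-linked e∈S = (_ , e∈S , inj₁ ≡.refl) ◅ ε

  -- Every edge is a bridge. This is equivalent to the absence of a `Cycle`, but it is decided by
  -- `linked?` and speaks of S without e, the set from which an exchange of edges starts.
  Acyclic : EdgeSet → Set
  Acyclic S = ∀ e → e ∈ S → ¬ Linked (S ∖ e) (head e) (tail e)

  Tree : EdgeSet → Set
  Tree S = ConnectedBy S × Acyclic S

  tree? : ∀ S → Dec (Tree S)
  tree? S = all? (λ u → all? λ v → linked? S u v)
    ×-dec all? (λ e → (e ∈? S) →-dec ¬? (linked? (S ∖ e) (head e) (tail e)))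

  linked-ends : ∀ {S e u v} → Joins e u v → Linked S u v → Linked S (head e) (tail e)
  linked-ends (inj₁ ≡.refl) p = p
  linked-ends (inj₂ ≡.refl) p = linked-sym p

  joins-end : ∀ {e u v u′ v′} → Joins e u v → Joins e u′ v′ → v′ ≡ u ⊎ v′ ≡ v
  joins-end (inj₁ ≡.refl) (inj₁ ≡.refl) = inj₂ ≡.refl
  joins-end (inj₁ ≡.refl) (inj₂ ≡.refl) = inj₁ ≡.refl
  joins-end (inj₂ ≡.refl) (inj₁ ≡.refl) = inj₁ ≡.refl
  joins-end (inj₂ ≡.refl) (inj₂ ≡.refl) = inj₂ ≡.refl

  -- The other steps of a cycle link the ends of its first edge without using that edge, which is
  -- therefore no bridge.
  acyclic⇒¬cycle : ∀ {S} → Acyclic S → ¬ Cycle S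
  acyclic⇒¬cycle {S} acyclic C = acyclic e e∈S (linked-ends e-joins (linked-sym detour))
    where
    open Cycle C
    e = proj₁ (step zero)
    e∈S = proj₁ (proj₂ (step zero))
    e-joins = proj₂ (proj₂ (step zero))

    -- No later vertex of the cycle is an endpoint of its first edge.
    later : ∀ {f u} i → Joins f u (vertex (suc (suc i))) → f ≢ e
    later i j ≡.refl with joins-end e-joins j
    ... | inj₁ eq with () ← injective eq
    ... | inj₂ eq with () ← injective eq

    open SimplePaths (Adjacent (S ∖ e)) using (chain)

    avoid : ∀ {f u} i → f ∈ S → Joins f u (vertex (suc (suc i))) →
            Adjacent (S ∖ e) u (vertex (suc (suc i)))
    avoid i f∈S j = _ , ∈-∖⁺ (later i j) f∈S , j

    detour : Linked (S ∖ e) (vertex (suc zero)) (vertex zero)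
    detour = chain (vertex ∘ suc) (λ i → let (_ , f∈S , j) = step (suc i) in avoid i f∈S j)
      ◅◅ (let (f , f∈S , j) = close in
          f , ∈-∖⁺ (later (fromℕ k) (swap j)) f∈S , j) ◅ ε

  -- A simple path that avoids e but links its ends is closed up by e to a cycle. Lengths 0 and 1
  -- are too short for a `Cycle`; there e would be a loop or would have a parallel edge.
  ¬cycle⇒acyclic : ∀ {S} → ¬ Cycle S → Acyclic S
  ¬cycle⇒acyclic {S} ¬cycle e e∈S p with SimplePaths.simplify _ p
  ... | SimplePaths.path 0 vertex inj step st en =
    loopless e (head e) (inj₁ (≡.cong (head e ,_) (≡.trans (≡.sym en) st)))
  ... | SimplePaths.path 1 vertex inj step st en with step zero
  ...   | f , f∈ , j
    with ≡.refl ← simple {f} {e} j (inj₁ (≡.cong₂ _,_ (≡.sym st) (≡.sym en))) = ∉-∖ {S = S} f∈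
  ¬cycle⇒acyclic {S} ¬cycle e e∈S p
      | SimplePaths.path (suc (suc k)) vertex inj step st en = ¬cycle record
    { k         = k
    ; vertex    = vertex
    ; injective = inj
    ; step      = λ i → let (f , f∈ , j) = step i in f , ∈-∖⁻ f∈ , j
    ; close     = e , e∈S , inj₂ (≡.cong₂ _,_ (≡.sym st) (≡.sym en))
    }

  spanningTree⇒tree : ∀ {S} → SpanningTree S → Tree S
  spanningTree⇒tree (conn , ¬cycle) = conn , ¬cycle⇒acyclic ¬cycle

  tree⇒spanningTree : ∀ {S} → Tree S → SpanningTree S
  tree⇒spanningTree (conn , acyclic) = conn , acyclic⇒¬cycle acyclic

  -- A walk from v to `head e` stays in S until it first uses e, and at that moment it stands at one
  -- of the ends of e.
  sides : ∀ {S e} → ConnectedBy (S ∪ e) → ∀ v → Linked S (head e) v ⊎ Linked S (tail e) v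
  sides {S} {e} conn v = go (conn v (head e))
    where
    go : ∀ {v} → Linked (S ∪ e) v (head e) → Linked S (head e) v ⊎ Linked S (tail e) v
    go ε = inj₁ ε
    go ((f , f∈ , j) ◅ p) with f ≟ᶠ e
    go ((f , f∈ , inj₁ ≡.refl) ◅ p) | yes ≡.refl = inj₁ ε
    go ((f , f∈ , inj₂ ≡.refl) ◅ p) | yes ≡.refl = inj₂ ε
    go ((f , f∈ , j) ◅ p) | no f≢e with go p
    ... | inj₁ q = inj₁ (q ◅◅ (f , ∈-∪⁻ f∈ f≢e , swap j) ◅ ε)
    ... | inj₂ q = inj₂ (q ◅◅ (f , ∈-∪⁻ f∈ f≢e , swap j) ◅ ε)

-- Sums and flows

module Sums {c ℓ} (R : CommutativeRing c ℓ) where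
  open CommutativeRing R hiding (zero)
  open RingSolver R
  open import Algebra.Properties.Semiring.Sum semiring public
    using (sum; sum-cong-≋; ∑-distrib-+; ∑-comm; *-distribˡ-sum; *-distribʳ-sum; sum-replicate-zero)
  open import Relation.Binary.Reasoning.Setoid setoid

  ⟦_⟧ : Bool → Carrier
  ⟦ b ⟧ = if b then 1# else 0#

  ⟦⟧-true : ∀ {a} {A : Set a} (d : Dec A) → A → ⟦ does d ⟧ ≈ 1#
  ⟦⟧-true d a = reflexive (≡.cong ⟦_⟧ (dec-true d a))

  ⟦⟧-false : ∀ {a} {A : Set a} (d : Dec A) → ¬ A → ⟦ does d ⟧ ≈ 0#
  ⟦⟧-false d ¬a = reflexive (≡.cong ⟦_⟧ (dec-false d ¬a))

  ⟦⟧-cong : ∀ {a b} {A : Set a} {B : Set b} (d : Dec A) (d′ : Dec B) →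
            (A → B) → (B → A) → ⟦ does d ⟧ ≈ ⟦ does d′ ⟧
  ⟦⟧-cong (yes a) d′ to from = sym (⟦⟧-true d′ (to a))
  ⟦⟧-cong (no ¬a) d′ to from = sym (⟦⟧-false d′ (¬a ∘ from))

  ⟦⟧-× : ∀ {a b c} {A : Set a} {B : Set b} {C : Set c} (d : Dec A) (d′ : Dec B) (d″ : Dec C) →
         (A → B → C) → (C → A × B) → ⟦ does d″ ⟧ ≈ ⟦ does d ⟧ * ⟦ does d′ ⟧
  ⟦⟧-× (yes a) (yes b) d″ to from = trans (⟦⟧-true d″ (to a b)) (sym (*-identityˡ 1#))
  ⟦⟧-× (yes _) (no ¬b) d″ to from = trans (⟦⟧-false d″ (¬b ∘ proj₂ ∘ from)) (sym (zeroʳ 1#))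
  ⟦⟧-× (no ¬a) d′      d″ to from = trans (⟦⟧-false d″ (¬a ∘ proj₁ ∘ from)) (sym (zeroˡ _))

  if-then-0 : ∀ b x → (if b then x else 0#) ≈ ⟦ b ⟧ * x
  if-then-0 true  x = sym (*-identityˡ x)
  if-then-0 false x = sym (zeroˡ x)

  δ : ∀ {n} → Fin n → Fin n → Carrier
  δ i j = ⟦ does (i ≟ᶠ j) ⟧

  δ-sym : ∀ {n} (i j : Fin n) → δ i j ≈ δ j i
  δ-sym i j = ⟦⟧-cong (i ≟ᶠ j) (j ≟ᶠ i) ≡.sym ≡.sym

  sum-zero : ∀ {n} {f : Fin n → Carrier} → (∀ i → f i ≈ 0#) → sum f ≈ 0#
  sum-zero {n} f≈0 = trans (sum-cong-≋ f≈0) (sum-replicate-zero n)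

  sum-single : ∀ {n} {f : Fin n → Carrier} i → (∀ j → j ≢ i → f j ≈ 0#) → sum f ≈ f i
  sum-single zero f≈0 =
    trans (+-congˡ (sum-zero λ j → f≈0 (suc j) λ ())) (+-identityʳ _)
  sum-single (suc i) f≈0 =
    trans (+-cong (f≈0 zero λ ()) (sum-single i λ j j≢i → f≈0 (suc j) (j≢i ∘ suc-injective)))
          (+-identityˡ _)

  sum-δ : ∀ {n} i (f : Fin n → Carrier) → sum (λ j → δ i j * f j) ≈ f i
  sum-δ i f = trans
    (sum-single i λ j j≢i → trans (*-congʳ (⟦⟧-false (i ≟ᶠ j) (j≢i ∘ ≡.sym))) (zeroˡ _))
    (trans (*-congʳ (⟦⟧-true (i ≟ᶠ i) ≡.refl)) (*-identityˡ _))

  sum-neg : ∀ {n} (f : Fin n → Carrier) → sum (λ i → - f i) ≈ - sum f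
  sum-neg {zero}  f = sym ε⁻¹≈ε
    where open import Algebra.Properties.Group +-group using (ε⁻¹≈ε)
  sum-neg {suc n} f = trans (+-congˡ (sum-neg (f ∘ suc))) (⁻¹-∙-comm _ _)
    where open import Algebra.Properties.AbelianGroup +-abelianGroup using (⁻¹-∙-comm)

  sum-- : ∀ {n} (f g : Fin n → Carrier) → sum (λ i → f i - g i) ≈ sum f - sum g
  sum-- f g = trans (∑-distrib-+ f _) (+-congˡ (sum-neg g))

module EdgeSetSums {c ℓ₁ ℓ₂ ℓ₃} (ℝ : RealField c ℓ₁ ℓ₂ ℓ₃) {n} (G : Graph n) where
  open RealField ℝ hiding (zero)
  open RingSolver commutativeRing
  open Sums commutativeRing hiding (sum)
  open Weighted ℝ G using (sumSubsets)
  open import Relation.Binary.Reasoning.Setoid setoid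

  Σˢ-cong : ∀ {m} {F H : Subset m → Carrier} → (∀ S → F S ≈ H S) → sumSubsets F ≈ sumSubsets H
  Σˢ-cong {zero}  F≈H = F≈H []
  Σˢ-cong {suc m} F≈H = +-cong (Σˢ-cong λ S → F≈H (outside ∷ S)) (Σˢ-cong λ S → F≈H (inside ∷ S))

  Σˢ-zero : ∀ {m} {F : Subset m → Carrier} → (∀ S → F S ≈ 0#) → sumSubsets F ≈ 0#
  Σˢ-zero {zero}  F≈0 = F≈0 []
  Σˢ-zero {suc m} F≈0 = trans
    (+-cong (Σˢ-zero λ S → F≈0 (outside ∷ S)) (Σˢ-zero λ S → F≈0 (inside ∷ S))) (+-identityˡ 0#)

  Σˢ-+ : ∀ {m} (F H : Subset m → Carrier) →
         sumSubsets (λ S → F S + H S) ≈ sumSubsets F + sumSubsets H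
  Σˢ-+ {zero}  F H = refl
  Σˢ-+ {suc m} F H = trans
    (+-cong (Σˢ-+ (F ∘ (outside ∷_)) _) (Σˢ-+ (F ∘ (inside ∷_)) _))
    (solve 4 (λ w x y z → (w :+ x) :+ (y :+ z) := (w :+ y) :+ (x :+ z)) refl _ _ _ _)

  Σˢ-- : ∀ {m} (F H : Subset m → Carrier) →
         sumSubsets (λ S → F S - H S) ≈ sumSubsets F - sumSubsets H
  Σˢ-- {zero}  F H = refl
  Σˢ-- {suc m} F H = trans
    (+-cong (Σˢ-- (F ∘ (outside ∷_)) _) (Σˢ-- (F ∘ (inside ∷_)) _))
    (solve 4 (λ w x y z → (w :- x) :+ (y :- z) := (w :+ y) :- (x :+ z)) refl _ _ _ _)

  Σˢ-* : ∀ {m} x (F : Subset m → Carrier) → sumSubsets (λ S → x * F S) ≈ x * sumSubsets F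
  Σˢ-* {zero}  x F = refl
  Σˢ-* {suc m} x F = trans
    (+-cong (Σˢ-* x (F ∘ (outside ∷_))) (Σˢ-* x (F ∘ (inside ∷_)))) (sym (distribˡ x _ _))

  Σˢ-sum : ∀ {m k} (F : Fin k → Subset m → Carrier) →
           sumSubsets (λ S → sum λ i → F i S) ≈ sum (λ i → sumSubsets (F i))
  Σˢ-sum {m} {zero}  F = Σˢ-zero {m} {λ _ → 0#} λ _ → refl
  Σˢ-sum {m} {suc k} F = trans (Σˢ-+ (F zero) _) (+-congˡ (Σˢ-sum (F ∘ suc)))

  -- Pairs each S that lacks e with S ∪ e. The sets that contain e get the value 0, so that the
  -- result is again a sum over all subsets.
  Σˢ-split : ∀ {m} (e : Fin m) (F : Subset m → Carrier) →
             sumSubsets F ≈ sumSubsets (λ S → if does (e ∈? S) then 0# else (F S + F (S ∪ e)))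
  Σˢ-split {suc m} zero F = begin
    sumSubsets F                                  ≈⟨ Σˢ-+ (F ∘ (outside ∷_)) _ ⟨
    sumSubsets (λ S → F (outside ∷ S) + F (inside ∷ S))
                                                  ≈⟨ +-identityʳ _ ⟨
    sumSubsets (λ S → F (outside ∷ S) + F (inside ∷ S)) + 0#
                                                  ≈⟨ +-congˡ (Σˢ-zero {m} {λ _ → 0#} λ _ → refl) ⟨
    _                                             ∎
  Σˢ-split (suc e) F = +-cong (Σˢ-split e (F ∘ (outside ∷_))) (Σˢ-split e (F ∘ (inside ∷_)))

  -- The supports are matched by S ∪ e and S ∪ g for S containing neither edge. Splitting one sum at
  -- e and the other at g makes both run over the same S, so no bijection of subsets has to be
  -- built.
  Σˢ-exchange : ∀ {m} {e g : Fin m} {F H : Subset m → Carrier} →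
    (∀ S → e ∉ S → F S ≈ 0#) → (∀ S → g ∈ S → F S ≈ 0#) →
    (∀ S → g ∉ S → H S ≈ 0#) → (∀ S → e ∈ S → H S ≈ 0#) →
    (∀ S → e ∉ S → g ∉ S → F (S ∪ e) ≈ H (S ∪ g)) →
    sumSubsets F ≈ sumSubsets H
  Σˢ-exchange {m} {e} {g} {F} {H} F-e F-g H-g H-e F≈H = begin
    sumSubsets F                                                       ≈⟨ Σˢ-split e F ⟩
    sumSubsets (λ S → if does (e ∈? S) then 0# else (F S + F (S ∪ e))) ≈⟨ Σˢ-cong termwise ⟩
    sumSubsets (λ S → if does (g ∈? S) then 0# else (H S + H (S ∪ g))) ≈⟨ Σˢ-split g H ⟨
    sumSubsets H                                                       ∎
    where
    termwise : ∀ S → (if does (e ∈? S) then 0# else (F S + F (S ∪ e)))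
                   ≈ (if does (g ∈? S) then 0# else (H S + H (S ∪ g)))
    termwise S with e ∈? S | g ∈? S
    ... | yes _   | yes _   = refl
    ... | yes e∈S | no g∉S  =
      sym (trans (+-cong (H-g S g∉S) (H-e (S ∪ g) (∈-∪⁺ e∈S))) (+-identityˡ 0#))
    ... | no e∉S  | yes g∈S =
      trans (+-cong (F-e S e∉S) (F-g (S ∪ e) (∈-∪⁺ g∈S))) (+-identityˡ 0#)
    ... | no e∉S  | no g∉S  = +-cong (trans (F-e S e∉S) (sym (H-g S g∉S))) (F≈H S e∉S g∉S)

  product-∪ : ∀ {m} (w : Fin m → Carrier) (S : Subset m) e → e ∉ S →
    product (λ f → if does (f ∈? (S ∪ e)) then w f else 1#) ≈
    w e * product (λ f → if does (f ∈? S) then w f else 1#)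
  product-∪ w (outside ∷ S) zero    e∉S = *-congˡ (sym (*-identityˡ _))
  product-∪ w (inside  ∷ S) zero    e∉S = ⊥-elim (e∉S here)
  product-∪ w (outside ∷ S) (suc e) e∉S = trans
    (*-congˡ (product-∪ (w ∘ suc) S e (e∉S ∘ there)))
    (solve 3 (λ x y z → x :* (y :* z) := y :* (x :* z)) refl _ _ _)
  product-∪ w (inside ∷ S) (suc e) e∉S = trans
    (*-congˡ (product-∪ (w ∘ suc) S e (e∉S ∘ there)))
    (solve 3 (λ x y z → x :* (y :* z) := y :* (x :* z)) refl _ _ _)

-- Potentials, flows and the exchange of tree edges

module Flows {c ℓ₁ ℓ₂ ℓ₃} (ℝ : RealField c ℓ₁ ℓ₂ ℓ₃) {n} (G : Graph n) where
  open RealField ℝ hiding (zero)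
  open CommutativeRing commutativeRing using (ring)
  open import Algebra.Properties.Ring ring using ([y-z]x≈yx-zx)
  open RingSolver commutativeRing
  open Sums commutativeRing hiding (sum)
  open Graph G
  open Weighted ℝ G
  open Trees G
  open import Relation.Binary.Reasoning.Setoid setoid

  x-x≈0 : ∀ {x y} → x ≈ y → x - y ≈ 0#
  x-x≈0 {x} {y} x≈y = trans (+-congʳ x≈y) (-‿inverseʳ y)

  x-0≈x : ∀ {x y} → y ≈ 0# → x - y ≈ x
  x-0≈x {x} {y} y≈0 = begin
    x - y        ≈⟨ +-congʳ (+-identityʳ x) ⟨
    x + 0# - y   ≈⟨ +-congʳ (+-congˡ y≈0) ⟨
    x + y - y    ≈⟨ solve 2 (λ x y → x :+ y :- y := x) refl x y ⟩
    x            ∎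

  -- Apartness in a Heyting field is invertibility of the difference, and 1 - 0 has the inverse 1.
  1≉0 : ¬ 1# ≈ 0#
  1≉0 1≈0 = #-irrefl 1≈0 (invertible⇒# (1# ,
    trans (*-identityˡ _) (x-0≈x refl) , trans (*-identityʳ _) (x-0≈x refl)))

  Potential : Set c
  Potential = Vertex → Carrier

  ∂ : Potential → Edge → Carrier
  ∂ ψ e = ψ (head e) - ψ (tail e)

  -- The walk as a 1-chain: the net number of its passages through e from head to tail.
  flow : ∀ {S u v} → Linked S u v → Edge → Carrier
  flow ε                      e = 0#
  flow ((f , _ , inj₁ _) ◅ p) e = δ f e + flow p e
  flow ((f , _ , inj₂ _) ◅ p) e = flow p e - δ f e

  flow-support : ∀ {S u v} (p : Linked S u v) e → e ∉ S → flow p e ≈ 0#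
  flow-support ε e e∉S = refl
  flow-support ((f , f∈S , inj₁ _) ◅ p) e e∉S = trans
    (+-cong (⟦⟧-false (f ≟ᶠ e) λ { ≡.refl → e∉S f∈S }) (flow-support p e e∉S)) (+-identityˡ 0#)
  flow-support ((f , f∈S , inj₂ _) ◅ p) e e∉S = trans
    (x-0≈x (⟦⟧-false (f ≟ᶠ e) λ { ≡.refl → e∉S f∈S })) (flow-support p e e∉S)

  -- The boundary of the chain, tested against potentials; the sum telescopes along the walk.
  flow-boundary : ∀ {S u v} (p : Linked S u v) ψ → sum (λ e → flow p e * ∂ ψ e) ≈ ψ u - ψ v
  flow-boundary {u = u} ε ψ = trans (sum-zero λ e → zeroˡ (∂ ψ e)) (sym (-‿inverseʳ (ψ u)))
  flow-boundary {u = u} {v} ((f , _ , inj₁ ≡.refl) ◅ p) ψ = begin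
    sum (λ e → (δ f e + flow p e) * ∂ ψ e)                       ≈⟨ sum-cong-≋ (λ e → distribʳ (∂ ψ e) (δ f e) (flow p e)) ⟩
    sum (λ e → δ f e * ∂ ψ e + flow p e * ∂ ψ e)                 ≈⟨ ∑-distrib-+ (λ e → δ f e * ∂ ψ e) _ ⟩
    sum (λ e → δ f e * ∂ ψ e) + sum (λ e → flow p e * ∂ ψ e)     ≈⟨ +-cong (sum-δ f (∂ ψ)) (flow-boundary p ψ) ⟩
    (ψ (head f) - ψ (tail f)) + (ψ (tail f) - ψ v)               ≈⟨ solve 3 (λ x y z → x :- y :+ (y :- z) := x :- z) refl _ _ _ ⟩
    ψ u - ψ v                                                    ∎
  flow-boundary {u = u} {v} ((f , _ , inj₂ ≡.refl) ◅ p) ψ = begin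
    sum (λ e → (flow p e - δ f e) * ∂ ψ e)                       ≈⟨ sum-cong-≋ (λ e → [y-z]x≈yx-zx (∂ ψ e) (flow p e) (δ f e)) ⟩
    sum (λ e → flow p e * ∂ ψ e - δ f e * ∂ ψ e)                 ≈⟨ sum-- (λ e → flow p e * ∂ ψ e) _ ⟩
    sum (λ e → flow p e * ∂ ψ e) - sum (λ e → δ f e * ∂ ψ e)     ≈⟨ +-cong (flow-boundary p ψ) (-‿cong (sum-δ f (∂ ψ))) ⟩
    (ψ (head f) - ψ v) - (ψ (head f) - ψ (tail f))               ≈⟨ solve 3 (λ x y z → x :- z :- (x :- y) := y :- z) refl _ _ _ ⟩
    ψ u - ψ v                                                    ∎

  -- No nonzero circulation lives on S; equivalently, the signed incidence vectors of the edges of S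
  -- are linearly independent.
  Independent : EdgeSet → Set (c ⊔ ℓ₁)
  Independent S = ∀ (y : Edge → Carrier) → (∀ e → e ∉ S → y e ≈ 0#) →
    (∀ ψ → sum (λ e → y e * ∂ ψ e) ≈ 0#) → ∀ e → y e ≈ 0#

  side : EdgeSet → Vertex → Potential
  side S u v = ⟦ does (linked? S u v) ⟧

  side-linked : ∀ {S u v v′} → Linked S v v′ → side S u v ≈ side S u v′
  side-linked {S} {u} {v} {v′} p =
    ⟦⟧-cong (linked? S u v) (linked? S u v′) (_◅◅ p) (_◅◅ linked-sym p)

  side-1 : ∀ {S u v} → Linked S u v → side S u v ≈ 1#
  side-1 = ⟦⟧-true (linked? _ _ _)

  side-0 : ∀ {S u v} → ¬ Linked S u v → side S u v ≈ 0#
  side-0 = ⟦⟧-false (linked? _ _ _)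

  ∂side-0 : ∀ {S u e} → Linked S (head e) (tail e) → ∂ (side S u) e ≈ 0#
  ∂side-0 p = x-x≈0 (side-linked p)

  -- The χ of the overview, defined for all edge sets.
  cut : EdgeSet → Edge → Potential
  cut S e = side (S ∖ e) (head e)

  ∂cut-other : ∀ {S e f} → f ∈ S → f ≢ e → ∂ (cut S e) f ≈ 0#
  ∂cut-other f∈S f≢e = ∂side-0 (edge-linked (∈-∖⁺ f≢e f∈S))

  ∂cut-self : ∀ {S e} → Acyclic S → e ∈ S → ∂ (cut S e) e ≈ 1#
  ∂cut-self {S} {e} acyclic e∈S = trans (x-0≈x (side-0 (acyclic _ e∈S))) (side-1 {S ∖ e} ε)

  -- On S the gradient of `cut S e` is 1 at e and 0 at the other edges, so pairing with it reads off
  -- one coefficient.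
  sum-∂cut : ∀ {S} → Acyclic S → ∀ (y : Edge → Carrier) → (∀ e → e ∉ S → y e ≈ 0#) →
             ∀ {e} → e ∈ S → sum (λ f → y f * ∂ (cut S e) f) ≈ y e
  sum-∂cut {S} acyclic y supp {e} e∈S =
    trans (sum-single e other) (trans (*-congˡ (∂cut-self acyclic e∈S)) (*-identityʳ _))
    where
    other : ∀ f → f ≢ e → y f * ∂ (cut S e) f ≈ 0#
    other f f≢e with f ∈? S
    ... | yes f∈S = trans (*-congˡ (∂cut-other f∈S f≢e)) (zeroʳ _)
    ... | no  f∉S = trans (*-congʳ (supp f f∉S)) (zeroˡ _)

  acyclic⇒independent : ∀ {S} → Acyclic S → Independent S
  acyclic⇒independent {S} acyclic y supp null e with e ∈? S
  ... | yes e∈S = trans (sym (sum-∂cut acyclic y supp e∈S)) (null (cut S e))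
  ... | no  e∉S = supp e e∉S

  -- A walk around e, closed up by e, is a circulation; its value at e is -1 because the walk avoids
  -- e.
  independent⇒acyclic : ∀ {S} → Independent S → Acyclic S
  independent⇒acyclic {S} indep e e∈S p = 1≉0 (begin
    1#                 ≈⟨ ⟦⟧-true (e ≟ᶠ e) ≡.refl ⟨
    δ e e              ≈⟨ solve 2 (λ x y → x := y :- (y :- x)) refl (δ e e) (flow p e) ⟩
    flow p e - y e     ≈⟨ x-0≈x (indep y supp null e) ⟩
    flow p e           ≈⟨ flow-support p e (∉-∖ {S = S}) ⟩
    0#                 ∎)
    where
    y : Edge → Carrier
    y f = flow p f - δ e f
    supp : ∀ f → f ∉ S → y f ≈ 0#
    supp f f∉S = trans (x-0≈x (⟦⟧-false (e ≟ᶠ f) λ { ≡.refl → f∉S e∈S }))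
                       (flow-support p f (f∉S ∘ ∈-∖⁻))
    null : ∀ ψ → sum (λ f → y f * ∂ ψ f) ≈ 0#
    null ψ = begin
      sum (λ f → (flow p f - δ e f) * ∂ ψ f)                    ≈⟨ sum-cong-≋ (λ f → [y-z]x≈yx-zx (∂ ψ f) (flow p f) (δ e f)) ⟩
      sum (λ f → flow p f * ∂ ψ f - δ e f * ∂ ψ f)              ≈⟨ sum-- (λ f → flow p f * ∂ ψ f) _ ⟩
      sum (λ f → flow p f * ∂ ψ f) - sum (λ f → δ e f * ∂ ψ f)  ≈⟨ x-x≈0 (trans (flow-boundary p ψ) (sym (sum-δ e (∂ ψ)))) ⟩
      0#                                                        ∎

  𝟙[_∈_] : Edge → EdgeSet → Carrier
  𝟙[ e ∈ S ] = ⟦ does (e ∈? S) ⟧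

  -- Pairing the flow of a walk from u to v with `cut S e` gives its value at e on the one hand and,
  -- by telescoping, the jump of the cut between u and v on the other.
  treeFlow : ∀ {S} → Tree S → ∀ u v ψ →
    sum (λ e → 𝟙[ e ∈ S ] * (cut S e u - cut S e v) * ∂ ψ e) ≈ ψ u - ψ v
  treeFlow {S} (conn , acyclic) u v ψ = trans (sum-cong-≋ λ e → *-congʳ (coefficient e)) (flow-boundary p ψ)
    where
    p = conn u v
    coefficient : ∀ e → 𝟙[ e ∈ S ] * (cut S e u - cut S e v) ≈ flow p e
    coefficient e with e ∈? S
    ... | no  e∉S = trans (zeroˡ _) (sym (flow-support p e e∉S))
    ... | yes e∈S = trans (*-identityˡ _) (trans (sym (flow-boundary p (cut S e)))
                      (sum-∂cut acyclic (flow p) (flow-support p) e∈S))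

  -- For a tree S through e this is 1 or -1 if g can replace e in S, the sign telling in which
  -- direction g crosses the cut, and 0 otherwise.
  transfer : EdgeSet → Edge → Edge → Carrier
  transfer S e g = 𝟙[ e ∈ S ] * ∂ (cut S e) g

  transfer-∉ : ∀ {S e g} → e ∉ S → transfer S e g ≈ 0#
  transfer-∉ e∉S = trans (*-congʳ (⟦⟧-false (_ ∈? _) e∉S)) (zeroˡ _)

  transfer-other : ∀ {S e g} → g ∈ S → g ≢ e → transfer S e g ≈ 0#
  transfer-other g∈S g≢e = trans (*-congˡ (∂cut-other g∈S g≢e)) (zeroʳ _)

  transfer-∪ : ∀ {S e g} → e ∉ S → transfer (S ∪ e) e g ≈ ∂ (side S (head e)) g
  transfer-∪ {S} {e} {g} e∉S = trans (*-congʳ (⟦⟧-true (e ∈? S ∪ e) (∈-∪ {S = S}))) (trans (*-identityˡ _)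
    (reflexive (≡.cong (λ T → ∂ (side T (head e)) g) (∪-∖ e∉S))))

  -- Edges of S do not cross the cut, so a circulation on S ∪ g pairs with it in the term of g
  -- alone. Hence it vanishes at g and lives on S. Squaring the jump covers both signs and supplies
  -- its inverse.
  exchange-independent : ∀ {S e g} → Independent (S ∪ e) →
    ∂ (side S (head e)) g * ∂ (side S (head e)) g ≈ 1# → Independent (S ∪ g)
  exchange-independent {S} {e} {g} indep unit y supp null = indep y supp′ null
    where
    χ = side S (head e)
    other : ∀ f → f ≢ g → y f * ∂ χ f ≈ 0#
    other f f≢g with f ∈? S
    ... | yes f∈S = trans (*-congˡ (∂side-0 (edge-linked f∈S))) (zeroʳ _)
    ... | no  f∉S = trans (*-congʳ (supp f λ f∈ → f∉S (∈-∪⁻ f∈ f≢g))) (zeroˡ _)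
    yg≈0 : y g ≈ 0#
    yg≈0 = begin
      y g                         ≈⟨ *-identityʳ (y g) ⟨
      y g * 1#                    ≈⟨ *-congˡ unit ⟨
      y g * (∂ χ g * ∂ χ g)       ≈⟨ *-assoc _ _ _ ⟨
      y g * ∂ χ g * ∂ χ g         ≈⟨ *-congʳ (trans (sym (sum-single g other)) (null χ)) ⟩
      0# * ∂ χ g                  ≈⟨ zeroˡ _ ⟩
      0#                          ∎
    supp′ : ∀ f → f ∉ S ∪ e → y f ≈ 0#
    supp′ f f∉ with f ≟ᶠ g
    ... | yes ≡.refl = yg≈0
    ... | no  f≢g    = supp f λ f∈ → f∉ (∈-∪⁺ (∈-∪⁻ f∈ f≢g))

  connected-via : ∀ {S e g} → ConnectedBy (S ∪ e) → Linked (S ∪ g) (head e) (tail e) → ConnectedBy (S ∪ g)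
  connected-via {S} {e} {g} conn p u v = linked-sym (toHead u) ◅◅ toHead v
    where
    toHead : ∀ v → Linked (S ∪ g) (head e) v
    toHead v with sides conn v
    ... | inj₁ q = linked-mono ∈-∪⁺ q
    ... | inj₂ q = p ◅◅ linked-mono ∈-∪⁺ q

  -- S falls into the components of `head e` and `tail e`. If g stays inside one of them, it closes
  -- a cycle. Otherwise it reconnects them, and the two signs agree because each tells whether
  -- `head e` and `head g` share a component.
  exchange-tree : ∀ {S e g} → e ∉ S → g ∉ S → Tree (S ∪ e) →
    (transfer (S ∪ e) e g ≈ 0# × ¬ Tree (S ∪ g)) ⊎
    (Tree (S ∪ g) × transfer (S ∪ e) e g ≈ transfer (S ∪ g) g e)
  exchange-tree {S} {e} {g} e∉S g∉S (conn , acyclic) =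
    cases (sides conn (head g)) (sides conn (tail g))
    where
    separated : ¬ Linked S (head e) (tail e)
    separated = ≡.subst (λ T → ¬ Linked T (head e) (tail e)) (∪-∖ e∉S) (acyclic e (∈-∪ {S = S}))

    Goal = (transfer (S ∪ e) e g ≈ 0# × ¬ Tree (S ∪ g)) ⊎
           (Tree (S ∪ g) × transfer (S ∪ e) e g ≈ transfer (S ∪ g) g e)

    same : Linked S (head g) (tail g) → Goal
    same p = inj₁ (trans (transfer-∪ e∉S) (∂side-0 p) ,
      λ (_ , acyclic′) → acyclic′ g (∈-∪ {S = S})
        (≡.subst (λ T → Linked T (head g) (tail g)) (≡.sym (∪-∖ g∉S)) p))

    across : ∀ {x} → x * x ≈ 1# → ∂ (side S (head e)) g ≈ x → ∂ (side S (head g)) e ≈ x →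
             Linked (S ∪ g) (head e) (tail e) → Goal
    across x²≈1 eg≈x ge≈x p = inj₂
      ( ( connected-via conn p
        , independent⇒acyclic (exchange-independent {e = e} (acyclic⇒independent acyclic)
            (trans (*-cong eg≈x eg≈x) x²≈1)))
      , trans (transfer-∪ e∉S) (trans eg≈x (trans (sym ge≈x) (sym (transfer-∪ g∉S)))))

    old : ∀ {u v} → Linked S u v → Linked (S ∪ g) u v
    old = linked-mono ∈-∪⁺

    cases : Linked S (head e) (head g) ⊎ Linked S (tail e) (head g) →
            Linked S (head e) (tail g) ⊎ Linked S (tail e) (tail g) → Goal
    cases (inj₁ p) (inj₁ q) = same (linked-sym p ◅◅ q)
    cases (inj₂ p) (inj₂ q) = same (linked-sym p ◅◅ q)
    cases (inj₁ p) (inj₂ q) = across {1#} (*-identityˡ 1#)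
      (trans (x-0≈x (side-0 λ r → separated (r ◅◅ linked-sym q))) (side-1 p))
      (trans (x-0≈x (side-0 λ r → separated (p ◅◅ r))) (side-1 (linked-sym p)))
      (old p ◅◅ edge-linked (∈-∪ {S = S}) ◅◅ old (linked-sym q))
    cases (inj₂ p) (inj₁ q) = across { - 1#}
      (trans (solve 1 (λ x → (:- x) :* (:- x) := x :* x) refl 1#) (*-identityˡ 1#))
      (trans (+-cong (side-0 λ r → separated (r ◅◅ linked-sym p)) (-‿cong (side-1 q))) (+-identityˡ _))
      (trans (+-cong (side-0 λ r → separated (linked-sym (p ◅◅ r))) (-‿cong (side-1 (linked-sym p))))
             (+-identityˡ _))
      (old q ◅◅ linked-sym (edge-linked (∈-∪ {S = S})) ◅◅ old (linked-sym p))

-- Potentials of a random spanning tree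

module Kirchhoff {c ℓ₁ ℓ₂ ℓ₃} (ℝ : RealField c ℓ₁ ℓ₂ ℓ₃) {n} (G : Graph n)
  (w : Graph.Edge G → RealField.Carrier ℝ)
  (w>0 : ∀ e → RealField._<_ ℝ (RealField.0# ℝ) (w e)) (r : Graph.Vertex G)
  (P : Weighted.EdgeSet ℝ G → RealField.Carrier ℝ) (law : Weighted.IsSpanningTreeLaw ℝ G w P) where
  open RealField ℝ hiding (zero)
  open CommutativeRing commutativeRing using (ring)
  open import Algebra.Properties.Ring ring using ([y-z]x≈yx-zx; x[y-z]≈xy-xz)
  open RingSolver commutativeRing
  open Sums commutativeRing hiding (sum)
  open Graph G
  open Weighted ℝ G
  open Moments P
  open EdgeSetSums ℝ G
  open Trees G
  open Flows ℝ G
  open IsSpanningTreeLaw law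
  open import Relation.Binary.Reasoning.Setoid setoid

  κ : Carrier
  κ = proj₁ proportional

  P-tree : ∀ {S} → Tree S → P S ≈ κ * treeWeight w S
  P-tree t = proj₂ proportional _ (tree⇒spanningTree t)

  P-¬tree : ∀ {S} → ¬ Tree S → P S ≈ 0#
  P-¬tree ¬t = supported _ (¬t ∘ spanningTree⇒tree)

  -- Agreement on trees is enough because `P` vanishes elsewhere; `tree?` makes the distinction
  -- constructive.
  𝔼-cong : ∀ {X Y} → (∀ {S} → Tree S → X S ≈ Y S) → 𝔼 X ≈ 𝔼 Y
  𝔼-cong {X} {Y} X≈Y = Σˢ-cong termwise
    where
    termwise : ∀ S → P S * X S ≈ P S * Y S
    termwise S with tree? S
    ... | yes t = *-congˡ (X≈Y t)
    ... | no ¬t = trans (trans (*-congʳ (P-¬tree ¬t)) (zeroˡ _))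
                        (sym (trans (*-congʳ (P-¬tree ¬t)) (zeroˡ _)))

  𝔼-cong′ : ∀ {X Y} → (∀ S → X S ≈ Y S) → 𝔼 X ≈ 𝔼 Y
  𝔼-cong′ X≈Y = 𝔼-cong λ {S} _ → X≈Y S

  𝔼-- : ∀ X Y → 𝔼 (λ S → X S - Y S) ≈ 𝔼 X - 𝔼 Y
  𝔼-- X Y = trans (Σˢ-cong λ S → x[y-z]≈xy-xz (P S) (X S) (Y S)) (Σˢ-- (λ S → P S * X S) _)

  𝔼-* : ∀ x X → 𝔼 (λ S → x * X S) ≈ x * 𝔼 X
  𝔼-* x X = trans
    (Σˢ-cong λ S → solve 3 (λ p x y → p :* (x :* y) := x :* (p :* y)) refl (P S) x (X S))
    (Σˢ-* x (λ S → P S * X S))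

  𝔼-*ʳ : ∀ X x → 𝔼 (λ S → X S * x) ≈ 𝔼 X * x
  𝔼-*ʳ X x = trans (𝔼-cong′ λ S → *-comm (X S) x) (trans (𝔼-* x X) (*-comm x _))

  𝔼-sum : ∀ {k} (X : Fin k → EdgeSet → Carrier) →
          𝔼 (λ S → sum λ i → X i S) ≈ sum λ i → 𝔼 (X i)
  𝔼-sum X = trans (Σˢ-cong λ S → *-distribˡ-sum (P S) (λ i → X i S))
                  (Σˢ-sum λ i S → P S * X i S)

  𝔼-1 : 𝔼 (λ _ → 1#) ≈ 1#
  𝔼-1 = trans (Σˢ-cong λ S → *-identityʳ (P S)) total

  -- `γ` must not notice the exchange of e for g. For two matched trees both sides carry the same
  -- weight κ w(e) w(g) `treeWeight w S`, and `exchange-tree` matches the signs.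
  reciprocity : ∀ (γ : EdgeSet → Carrier) e g → (∀ S → e ∉ S → g ∉ S → γ (S ∪ e) ≈ γ (S ∪ g)) → e ≢ g →
    w g * 𝔼 (λ S → γ S * transfer S e g) ≈ w e * 𝔼 (λ S → γ S * transfer S g e)
  reciprocity γ e g γ-∪ e≢g = begin
    w g * 𝔼 (λ S → γ S * transfer S e g)                          ≈⟨ Σˢ-* (w g) (λ S → P S * (γ S * transfer S e g)) ⟨
    sumSubsets (λ S → w g * (P S * (γ S * transfer S e g)))       ≈⟨ Σˢ-exchange
      (λ S e∉S → vanish (*-congˡ (trans (*-congˡ (transfer-∉ e∉S)) (zeroʳ _))))
      (λ S g∈S → vanish (*-congˡ (trans (*-congˡ (transfer-other g∈S (e≢g ∘ ≡.sym))) (zeroʳ _))))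
      (λ S g∉S → vanish (*-congˡ (trans (*-congˡ (transfer-∉ g∉S)) (zeroʳ _))))
      (λ S e∈S → vanish (*-congˡ (trans (*-congˡ (transfer-other e∈S e≢g)) (zeroʳ _))))
      exchanged ⟩
    sumSubsets (λ S → w e * (P S * (γ S * transfer S g e)))       ≈⟨ Σˢ-* (w e) (λ S → P S * (γ S * transfer S g e)) ⟩
    w e * 𝔼 (λ S → γ S * transfer S g e)                          ∎
    where
    vanish : ∀ {x p y} → p * y ≈ p * 0# → x * (p * y) ≈ 0#
    vanish eq = trans (*-congˡ (trans eq (zeroʳ _))) (zeroʳ _)

    improbable : ∀ {x S y} → ¬ Tree S → x * (P S * y) ≈ 0#
    improbable ¬t = trans (*-congˡ (trans (*-congʳ (P-¬tree ¬t)) (zeroˡ _))) (zeroʳ _)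

    exchanged : ∀ S → e ∉ S → g ∉ S →
      w g * (P (S ∪ e) * (γ (S ∪ e) * transfer (S ∪ e) e g)) ≈
      w e * (P (S ∪ g) * (γ (S ∪ g) * transfer (S ∪ g) g e))
    exchanged S e∉S g∉S with tree? (S ∪ e) | tree? (S ∪ g)
    ... | no ¬t | no ¬t′ = trans (improbable ¬t) (sym (improbable ¬t′))
    -- The exchange is run backwards from S ∪ g: as S ∪ e is no tree, the transfer must be zero.
    ... | no ¬t | yes t′ with exchange-tree g∉S e∉S t′
    ...   | inj₁ (zero-transfer , _) = trans (improbable ¬t)
            (sym (vanish (*-congˡ (trans (*-congˡ zero-transfer) (zeroʳ _)))))
    ...   | inj₂ (t , _) = ⊥-elim (¬t t)
    exchanged S e∉S g∉S | yes t | _ with exchange-tree e∉S g∉S t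
    ...   | inj₁ (zero-transfer , ¬t′) = trans
            (vanish (*-congˡ (trans (*-congˡ zero-transfer) (zeroʳ _)))) (sym (improbable ¬t′))
    ...   | inj₂ (t′ , eq) = begin
      w g * (P (S ∪ e) * (γ (S ∪ e) * transfer (S ∪ e) e g))
        ≈⟨ *-congˡ (*-cong (trans (P-tree t) (*-congˡ (product-∪ w S e e∉S)))
                           (*-cong (γ-∪ S e∉S g∉S) eq)) ⟩
      w g * (κ * (w e * treeWeight w S) * (γ (S ∪ g) * transfer (S ∪ g) g e))
        ≈⟨ solve 5 (λ a k b t x → a :* (k :* (b :* t) :* x) := b :* (k :* (a :* t) :* x)) refl
             (w g) κ (w e) (treeWeight w S) _ ⟩
      w e * (κ * (w g * treeWeight w S) * (γ (S ∪ g) * transfer (S ∪ g) g e))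
        ≈⟨ *-congˡ (*-congʳ (trans (P-tree t′) (*-congˡ (product-∪ w S g g∉S)))) ⟨
      w e * (P (S ∪ g) * (γ (S ∪ g) * transfer (S ∪ g) g e)) ∎

  -- Averaged over the random tree, the tree paths from u to v form a flow of strength `𝔼 γ`.
  averageFlow : ∀ γ u v ψ →
    sum (λ e → 𝔼 (λ S → γ S * (𝟙[ e ∈ S ] * (cut S e u - cut S e v))) * ∂ ψ e) ≈ 𝔼 γ * (ψ u - ψ v)
  averageFlow γ u v ψ = begin
    sum (λ e → 𝔼 (λ S → γ S * N S e) * ∂ ψ e)           ≈⟨ sum-cong-≋ (λ e → sym (𝔼-*ʳ (λ S → γ S * N S e) (∂ ψ e))) ⟩
    sum (λ e → 𝔼 (λ S → γ S * N S e * ∂ ψ e))           ≈⟨ 𝔼-sum (λ e S → γ S * N S e * ∂ ψ e) ⟨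
    𝔼 (λ S → sum λ e → γ S * N S e * ∂ ψ e)             ≈⟨ 𝔼-cong (λ {S} t → begin
      (sum λ e → γ S * N S e * ∂ ψ e)                     ≈⟨ sum-cong-≋ (λ e → *-assoc (γ S) (N S e) (∂ ψ e)) ⟩
      (sum λ e → γ S * (N S e * ∂ ψ e))                   ≈⟨ *-distribˡ-sum (γ S) (λ e → N S e * ∂ ψ e) ⟨
      γ S * (sum λ e → N S e * ∂ ψ e)                     ≈⟨ *-congˡ (treeFlow t u v ψ) ⟩
      γ S * (ψ u - ψ v)                                   ∎) ⟩
    𝔼 (λ S → γ S * (ψ u - ψ v))                         ≈⟨ 𝔼-*ʳ γ (ψ u - ψ v) ⟩
    𝔼 γ * (ψ u - ψ v)                                   ∎
    where
    N : EdgeSet → Edge → Carrier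
    N S e = 𝟙[ e ∈ S ] * (cut S e u - cut S e v)

  -- The potential of the overview, with the additional random factor `γ`.
  φ : (EdgeSet → Carrier) → Edge → Potential
  φ γ e v = 𝔼 λ S → γ S * (𝟙[ e ∈ S ] * (cut S e v - cut S e r))

  Y : (EdgeSet → Carrier) → Edge → Edge → Carrier
  Y γ e g = 𝔼 λ S → γ S * transfer S e g

  ∂φ : ∀ γ e g → ∂ (φ γ e) g ≈ Y γ e g
  ∂φ γ e g = trans (sym (𝔼-- _ _)) (𝔼-cong′ λ S →
    solve 5 (λ γ i h t r → γ :* (i :* (h :- r)) :- γ :* (i :* (t :- r)) := γ :* (i :* (h :- t))) refl
      (γ S) 𝟙[ e ∈ S ] (cut S e (head g)) (cut S e (tail g)) (cut S e r))

  φ-r : ∀ γ e → φ γ e r ≈ 0#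
  φ-r γ e = Σˢ-zero λ S → trans (*-congˡ (trans (*-congˡ
    (trans (*-congˡ {𝟙[ e ∈ S ]} (x-x≈0 {cut S e r} refl)) (zeroʳ _))) (zeroʳ _))) (zeroʳ _)

  -- The Dirichlet form, that is, the bilinear form of `laplacian w`.
  energy : Potential → Potential → Carrier
  energy φ ψ = sum λ f → w f * (∂ φ f * ∂ ψ f)

  energy-sym : ∀ φ ψ → energy φ ψ ≈ energy ψ φ
  energy-sym φ ψ = sum-cong-≋ λ f → *-congˡ (*-comm (∂ φ f) (∂ ψ f))

  -- `z` is the defect of reciprocity: zero for `one`, concentrated at f for the trees through f.
  -- Apart from it, the gradient of `φ γ e` becomes the averaged flow between the ends of e.
  energy-φ : ∀ γ e (z : Edge → Carrier) ψ →
    (∀ g → w g * Y γ e g ≈ w e * (Y γ g e - z g)) →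
    energy (φ γ e) ψ ≈ w e * (𝔼 γ * ∂ ψ e - sum (λ g → z g * ∂ ψ g))
  energy-φ γ e z ψ swapped = begin
    sum (λ g → w g * (∂ (φ γ e) g * ∂ ψ g))                 ≈⟨ sum-cong-≋ (λ g → trans (sym (*-assoc _ _ _))
                                                                 (*-congʳ (trans (*-congˡ (∂φ γ e g)) (swapped g)))) ⟩
    sum (λ g → w e * (Y γ g e - z g) * ∂ ψ g)               ≈⟨ sum-cong-≋ (λ g → trans (*-assoc _ _ _)
                                                                 (*-congˡ ([y-z]x≈yx-zx (∂ ψ g) (Y γ g e) (z g)))) ⟩
    sum (λ g → w e * (Y γ g e * ∂ ψ g - z g * ∂ ψ g))       ≈⟨ *-distribˡ-sum (w e) (λ g → Y γ g e * ∂ ψ g - z g * ∂ ψ g) ⟨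
    w e * sum (λ g → Y γ g e * ∂ ψ g - z g * ∂ ψ g)         ≈⟨ *-congˡ (sum-- (λ g → Y γ g e * ∂ ψ g) (λ g → z g * ∂ ψ g)) ⟩
    w e * (sum (λ g → Y γ g e * ∂ ψ g) - sum (λ g → z g * ∂ ψ g))
                                                            -- Between the ends of e the averaged
                                                            -- flow through g is `Y γ g e` by
                                                            -- definition.
                                                            ≈⟨ *-congˡ (+-congʳ (averageFlow γ (head e) (tail e) ψ)) ⟩
    w e * (𝔼 γ * ∂ ψ e - sum (λ g → z g * ∂ ψ g))           ∎

  one : EdgeSet → Carrier
  one _ = 1#

  φ₁ : Edge → Potential
  φ₁ = φ one

  Y₁ : Edge → Edge → Carrier
  Y₁ = Y one

  Y₁-sym : ∀ e g → w g * Y₁ e g ≈ w e * Y₁ g e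
  Y₁-sym e g with e ≟ᶠ g
  ... | yes ≡.refl = refl
  ... | no e≢g     = reciprocity one e g (λ _ _ _ → refl) e≢g

  energy-φ₁ : ∀ e ψ → energy (φ₁ e) ψ ≈ w e * ∂ ψ e
  energy-φ₁ e ψ = trans
    (energy-φ one e (λ _ → 0#) ψ λ g → trans (Y₁-sym e g) (*-congˡ (sym (x-0≈x refl))))
    (*-congˡ (trans (x-0≈x (sum-zero λ g → zeroˡ (∂ ψ g))) (trans (*-congʳ 𝔼-1) (*-identityˡ _))))

  p : Edge → Carrier
  p e = 𝔼 λ S → 𝟙[ e ∈ S ]

  p₂ : Edge → Edge → Carrier
  p₂ f e = 𝔼 λ S → 𝟙[ f ∈ S ] * 𝟙[ e ∈ S ]

  Y-self : ∀ γ e → Y γ e e ≈ 𝔼 λ S → γ S * 𝟙[ e ∈ S ]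
  Y-self γ e = 𝔼-cong λ {S} t → *-congˡ (transfer-self t)
    where
    transfer-self : ∀ {S} → Tree S → transfer S e e ≈ 𝟙[ e ∈ S ]
    transfer-self {S} (_ , acyclic) with e ∈? S
    ... | yes e∈S = trans (*-identityˡ _) (∂cut-self acyclic e∈S)
    ... | no  e∉S = zeroˡ _

  Y₁-self : ∀ e → Y₁ e e ≈ p e
  Y₁-self e = trans (Y-self one e) (𝔼-cong′ λ S → *-identityˡ _)

  -- The event f ∈ S survives the exchange of e for g unless g = f, where the left side is 0.
  Y-through : ∀ {f e} → e ≢ f → ∀ g →
    w g * Y (λ S → 𝟙[ f ∈ S ]) e g ≈ w e * (Y (λ S → 𝟙[ f ∈ S ]) g e - δ f g * Y₁ f e)
  Y-through {f} {e} e≢f g with e ≟ᶠ g | f ≟ᶠ g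
  ... | yes ≡.refl | yes ≡.refl = ⊥-elim (e≢f ≡.refl)
  ... | yes ≡.refl | no f≢g = *-congˡ (sym (x-0≈x (zeroˡ _)))
  ... | no e≢g     | no f≢g = trans (reciprocity (λ S → 𝟙[ f ∈ S ]) e g same e≢g) (*-congˡ (sym (x-0≈x (zeroˡ _))))
    where
    same : ∀ S → e ∉ S → g ∉ S → 𝟙[ f ∈ S ∪ e ] ≈ 𝟙[ f ∈ S ∪ g ]
    same S _ _ = ⟦⟧-cong (f ∈? S ∪ e) (f ∈? S ∪ g)
      (λ f∈ → ∈-∪⁺ (∈-∪⁻ f∈ (e≢f ∘ ≡.sym))) (λ f∈ → ∈-∪⁺ (∈-∪⁻ f∈ f≢g))
  ... | no e≢g     | yes ≡.refl = begin
    w f * Y γ e f                       ≈⟨ *-congˡ (Σˢ-zero λ S → trans (*-congˡ (blocked S)) (zeroʳ _)) ⟩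
    w f * 0#                            ≈⟨ zeroʳ _ ⟩
    0#                                  ≈⟨ zeroʳ _ ⟨
    w e * 0#                            ≈⟨ *-congˡ (x-x≈0 (sym (trans (*-identityˡ _) (𝔼-cong′ λ S → sym (absorb S))))) ⟨
    w e * (Y γ f e - 1# * Y₁ f e)       ∎
    where
    γ : EdgeSet → Carrier
    γ S = 𝟙[ f ∈ S ]
    blocked : ∀ S → γ S * transfer S e f ≈ 0#
    blocked S with f ∈? S
    ... | yes f∈S = trans (*-congˡ (transfer-other f∈S (e≢f ∘ ≡.sym))) (zeroʳ _)
    ... | no  _   = zeroˡ _
    absorb : ∀ S → γ S * transfer S f e ≈ 1# * transfer S f e
    absorb S with f ∈? S
    ... | yes _ = refl
    ... | no  _ = trans (zeroˡ _) (sym (trans (*-identityˡ _) (zeroˡ _)))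

  invertible : ∀ e → ∃[ x ] x * w e ≈ 1#
  invertible e with #⇒invertible (#-sym (<⇒# (w>0 e)))
  ... | x , left , _ = x , trans (*-congˡ (sym (x-0≈x refl))) left

  w⁻¹ : Edge → Carrier
  w⁻¹ e = proj₁ (invertible e)

  w⁻¹*w : ∀ e x → w⁻¹ e * (w e * x) ≈ x
  w⁻¹*w e x = trans (sym (*-assoc _ _ _)) (trans (*-congʳ (proj₂ (invertible e))) (*-identityˡ x))

  w-cancel : ∀ e {x y} → w e * x ≈ w e * y → x ≈ y
  w-cancel e eq = trans (sym (w⁻¹*w e _)) (trans (*-congˡ eq) (w⁻¹*w e _))

  -- Both sides compute the energy of φ₁ e against the potential of e for the trees through f.
  pair-probability : ∀ {f e} → e ≢ f → p₂ f e ≈ p f * p e - Y₁ f e * Y₁ e f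
  pair-probability {f} {e} e≢f = w-cancel e (begin
    w e * p₂ f e                                    ≈⟨ *-congˡ (trans (∂φ γ e e) (Y-self γ e)) ⟨
    w e * ∂ (φ γ e) e                               ≈⟨ energy-φ₁ e (φ γ e) ⟨
    energy (φ₁ e) (φ γ e)                           ≈⟨ energy-sym (φ₁ e) (φ γ e) ⟩
    energy (φ γ e) (φ₁ e)                           ≈⟨ energy-φ γ e (λ g → δ f g * Y₁ f e) (φ₁ e) (Y-through e≢f) ⟩
    w e * (p f * ∂ (φ₁ e) e - sum (λ g → δ f g * Y₁ f e * ∂ (φ₁ e) g))
      ≈⟨ *-congˡ (+-cong (*-congˡ (trans (∂φ one e e) (Y₁-self e)))
           (-‿cong (trans (sum-cong-≋ λ g → *-assoc (δ f g) (Y₁ f e) (∂ (φ₁ e) g))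
                   (trans (sum-δ f (λ g → Y₁ f e * ∂ (φ₁ e) g)) (*-congˡ (∂φ one e f)))))) ⟩
    w e * (p f * p e - Y₁ f e * Y₁ e f)             ∎)
    where
    γ : EdgeSet → Carrier
    γ S = 𝟙[ f ∈ S ]

  -- For f = e this is the variance p - p p of an indicator, since `Y₁ e e` is `p e`. With the
  -- diagonal included, the degree sums can run over all pairs of edges.
  covariance : ∀ f e → p₂ f e - p f * p e ≈ δ f e * p e - Y₁ f e * Y₁ e f
  covariance f e with f ≟ᶠ e
  ... | yes ≡.refl = +-cong
    (trans (𝔼-cong′ idempotent) (sym (*-identityˡ _)))
    (-‿cong (*-cong (sym (Y₁-self e)) (sym (Y₁-self e))))
    where
    idempotent : ∀ S → 𝟙[ e ∈ S ] * 𝟙[ e ∈ S ] ≈ 𝟙[ e ∈ S ]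
    idempotent S with e ∈? S
    ... | yes _ = *-identityˡ 1#
    ... | no  _ = zeroˡ 0#
  ... | no f≢e = begin
    p₂ f e - p f * p e                            ≈⟨ +-congʳ (pair-probability (f≢e ∘ ≡.sym)) ⟩
    (p f * p e - Y₁ f e * Y₁ e f) - p f * p e     ≈⟨ solve 2 (λ a b → a :- b :- a := :- b) refl _ _ ⟩
    - (Y₁ f e * Y₁ e f)                           ≈⟨ +-identityˡ _ ⟨
    0# - Y₁ f e * Y₁ e f                          ≈⟨ +-congʳ (zeroˡ (p e)) ⟨
    0# * p e - Y₁ f e * Y₁ e f                    ∎

  -- The formula comes from Γ = Γ L Γ with L = Σ w(e) b_e b_eᵀ and φ_e = w(e) Γ b_e. Symmetry and
  -- vanishing at r are then immediate.
  green : Vertex → Potential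
  green v u = sum λ e → w⁻¹ e * (φ₁ e v * φ₁ e u)

  green-sym : ∀ u v → green u v ≈ green v u
  green-sym u v = sum-cong-≋ λ e → *-congˡ (*-comm (φ₁ e u) (φ₁ e v))

  green-r : ∀ v → green v r ≈ 0#
  green-r v = sum-zero λ e → trans (*-congˡ (trans (*-congˡ (φ-r one e)) (zeroʳ _))) (zeroʳ _)

  ∂green : ∀ v f → ∂ (green v) f ≈ sum λ e → w⁻¹ e * (φ₁ e v * ∂ (φ₁ e) f)
  ∂green v f = trans
    (sym (sum-- (λ e → w⁻¹ e * (φ₁ e v * φ₁ e (head f))) (λ e → w⁻¹ e * (φ₁ e v * φ₁ e (tail f)))))
    (sum-cong-≋ λ e → solve 4 (λ a b x y → a :* (b :* x) :- a :* (b :* y) := a :* (b :* (x :- y))) refl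
      (w⁻¹ e) (φ₁ e v) (φ₁ e (head f)) (φ₁ e (tail f)))

  -- The reproducing property: Kirchhoff's law cancels the factors `w⁻¹`, and what remains is the
  -- averaged tree path from v to r.
  energy-green : ∀ v ψ → energy (green v) ψ ≈ ψ v - ψ r
  energy-green v ψ = begin
    sum (λ f → w f * (∂ (green v) f * ∂ ψ f))
      ≈⟨ sum-cong-≋ (λ f → trans (*-congˡ (*-congʳ (∂green v f))) (trans
           (solve 3 (λ a s b → a :* (s :* b) := (a :* b) :* s) refl (w f) _ (∂ ψ f))
           (*-distribˡ-sum (w f * ∂ ψ f) (λ e → w⁻¹ e * (φ₁ e v * ∂ (φ₁ e) f))))) ⟩
    sum (λ f → sum λ e → w f * ∂ ψ f * (w⁻¹ e * (φ₁ e v * ∂ (φ₁ e) f)))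
      ≈⟨ ∑-comm (λ f e → w f * ∂ ψ f * (w⁻¹ e * (φ₁ e v * ∂ (φ₁ e) f))) ⟩
    sum (λ e → sum λ f → w f * ∂ ψ f * (w⁻¹ e * (φ₁ e v * ∂ (φ₁ e) f)))
      ≈⟨ sum-cong-≋ (λ e → trans
           (sum-cong-≋ λ f → solve 5 (λ a b i x y → a :* b :* (i :* (x :* y)) := x :* i :* (a :* (y :* b))) refl
             (w f) (∂ ψ f) (w⁻¹ e) (φ₁ e v) (∂ (φ₁ e) f))
           (sym (*-distribˡ-sum (φ₁ e v * w⁻¹ e) (λ f → w f * (∂ (φ₁ e) f * ∂ ψ f))))) ⟩
    sum (λ e → φ₁ e v * w⁻¹ e * energy (φ₁ e) ψ)
      ≈⟨ sum-cong-≋ (λ e → trans (*-assoc _ _ _) (*-congˡ (trans (*-congˡ (energy-φ₁ e ψ)) (w⁻¹*w e _)))) ⟩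
    sum (λ e → φ₁ e v * ∂ ψ e)
      ≈⟨ averageFlow one v r ψ ⟩
    𝔼 one * (ψ v - ψ r)
      ≈⟨ trans (*-congʳ 𝔼-1) (*-identityˡ _) ⟩
    ψ v - ψ r ∎

  -- The energy of `green v` and `φ₁ e` is evaluated by the reproducing property and by Kirchhoff's
  -- law.
  φ₁-green : ∀ e v → φ₁ e v ≈ w e * ∂ (green v) e
  φ₁-green e v = begin
    φ₁ e v                    ≈⟨ x-0≈x (φ-r one e) ⟨
    φ₁ e v - φ₁ e r           ≈⟨ energy-green v (φ₁ e) ⟨
    energy (green v) (φ₁ e)   ≈⟨ energy-sym (green v) (φ₁ e) ⟩
    energy (φ₁ e) (green v)   ≈⟨ energy-φ₁ e (green v) ⟩
    w e * ∂ (green v) e       ∎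

  -- The number b_eᵀ Γ b_f of the overview; unlike `Y₁` it is symmetric.
  K : Edge → Edge → Carrier
  K e f = ∂ (λ v → ∂ (green v) e) f

  K-sym : ∀ e f → K e f ≈ K f e
  K-sym e f = trans
    (+-cong (+-cong (green-sym _ _) (-‿cong (green-sym _ _)))
            (-‿cong (+-cong (green-sym _ _) (-‿cong (green-sym _ _)))))
    (solve 4 (λ a b c d → a :- b :- (c :- d) := a :- c :- (b :- d)) refl _ _ _ _)

  Y₁-K : ∀ e f → Y₁ e f ≈ w e * K e f
  Y₁-K e f = begin
    Y₁ e f                                                            ≈⟨ ∂φ one e f ⟨
    ∂ (φ₁ e) f                                                        ≈⟨ +-cong (φ₁-green e _) (-‿cong (φ₁-green e _)) ⟩
    w e * ∂ (green (head f)) e - w e * ∂ (green (tail f)) e           ≈⟨ x[y-z]≈xy-xz (w e) _ _ ⟨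
    w e * K e f                                                       ∎

  degreeSum : (Edge → Carrier) → EdgeSet → Carrier
  degreeSum a S = sum λ e → a e * 𝟙[ e ∈ S ]

  𝔼-degreeSum : ∀ a → 𝔼 (degreeSum a) ≈ sum λ e → a e * (w e * K e e)
  𝔼-degreeSum a = trans (𝔼-sum λ e S → a e * 𝟙[ e ∈ S ])
    (sum-cong-≋ λ e → trans (𝔼-* (a e) _) (*-congˡ (trans (sym (Y₁-self e)) (Y₁-K e e))))

  𝔼-cong-Cov : ∀ {X X′ Z Z′} → (∀ S → X S ≈ X′ S) → (∀ S → Z S ≈ Z′ S) → Cov X Z ≈ Cov X′ Z′
  𝔼-cong-Cov X≈ Z≈ = 𝔼-cong′ λ S → *-cong (+-cong (X≈ S) (-‿cong (𝔼-cong′ X≈))) (+-cong (Z≈ S) (-‿cong (𝔼-cong′ Z≈)))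

  Cov-𝔼 : ∀ X Z → Cov X Z ≈ 𝔼 (λ S → X S * Z S) - 𝔼 X * 𝔼 Z
  Cov-𝔼 X Z = begin
    𝔼 (λ S → (X S - x) * (Z S - z))
      -- Split so that the middle term contains the centred variable `Z S - z`, whose expectation is
      -- 0.
      ≈⟨ 𝔼-cong′ (λ S → solve 4 (λ a x b z → (a :- x) :* (b :- z)
           := a :* b :- x :* (b :- z) :- z :* a) refl (X S) x (Z S) z) ⟩
    𝔼 (λ S → X S * Z S - x * (Z S - z) - z * X S)
      ≈⟨ 𝔼-- (λ S → X S * Z S - x * (Z S - z)) _ ⟩
    𝔼 (λ S → X S * Z S - x * (Z S - z)) - 𝔼 (λ S → z * X S)
      ≈⟨ +-cong (𝔼-- (λ S → X S * Z S) _) (-‿cong (𝔼-* z X)) ⟩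
    𝔼 (λ S → X S * Z S) - 𝔼 (λ S → x * (Z S - z)) - z * x
      ≈⟨ +-congʳ (+-congˡ (-‿cong (trans (𝔼-* x _) (trans (*-congˡ centred) (zeroʳ _))))) ⟩
    𝔼 (λ S → X S * Z S) - 0# - z * x
      ≈⟨ +-cong (x-0≈x refl) (-‿cong (*-comm z x)) ⟩
    𝔼 (λ S → X S * Z S) - x * z                        ∎
    where
    x = 𝔼 X
    z = 𝔼 Z
    centred : 𝔼 (λ S → Z S - z) ≈ 0#
    centred = trans (𝔼-- Z _) (x-x≈0 (sym (trans
      (𝔼-cong′ λ S → sym (*-identityʳ z)) (trans (𝔼-* z one) (trans (*-congˡ 𝔼-1) (*-identityʳ z))))))

  sum-* : ∀ {k} (x y : Fin k → Carrier) → sum x * sum y ≈ sum λ i → sum λ j → x i * y j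
  sum-* x y = trans (*-distribʳ-sum (sum y) x) (sum-cong-≋ λ i → *-distribˡ-sum (x i) y)

  Cov-degreeSum : ∀ a b → Cov (degreeSum a) (degreeSum b) ≈
    sum (λ e → a e * b e * (w e * K e e)) -
    sum (λ e → (w e * a e) * sum λ f → (w f * b f) * (K e f * K f e))
  Cov-degreeSum a b = begin
    Cov (degreeSum a) (degreeSum b)
      ≈⟨ Cov-𝔼 (degreeSum a) (degreeSum b) ⟩
    𝔼 (λ S → degreeSum a S * degreeSum b S) - 𝔼 (degreeSum a) * 𝔼 (degreeSum b)
      ≈⟨ +-cong second (-‿cong (trans (*-cong (first a) (first b)) (sum-* (λ e → a e * p e) (λ f → b f * p f)))) ⟩
    sum (λ e → sum λ f → a e * b f * p₂ e f) - sum (λ e → sum λ f → (a e * p e) * (b f * p f))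
      ≈⟨ trans (sym (sum-- (λ e → sum λ f → a e * b f * p₂ e f) (λ e → sum λ f → (a e * p e) * (b f * p f))))
             (sum-cong-≋ λ e → sym (sum-- (λ f → a e * b f * p₂ e f) (λ f → (a e * p e) * (b f * p f)))) ⟩
    sum (λ e → sum λ f → a e * b f * p₂ e f - (a e * p e) * (b f * p f))
      ≈⟨ sum-cong-≋ (λ e → sum-cong-≋ λ f → begin
           a e * b f * p₂ e f - (a e * p e) * (b f * p f)
             ≈⟨ solve 5 (λ a b q x y → a :* b :* q :- (a :* x) :* (b :* y) := a :* b :* (q :- x :* y)) refl
                  (a e) (b f) (p₂ e f) (p e) (p f) ⟩
           a e * b f * (p₂ e f - p e * p f)
             ≈⟨ *-congˡ (trans (covariance e f) (+-cong
                  (*-congˡ (trans (sym (Y₁-self f)) (Y₁-K f f)))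
                  (-‿cong (*-cong (Y₁-K e f) (Y₁-K f e))))) ⟩
           a e * b f * (δ e f * (w f * K f f) - (w e * K e f) * (w f * K f e))
             ≈⟨ solve 8 (λ a b d w k v x y → a :* b :* (d :* (v :* k) :- (w :* x) :* (v :* y))
                  := d :* (a :* b :* (v :* k)) :- (w :* a) :* ((v :* b) :* (x :* y))) refl
                  (a e) (b f) (δ e f) (w e) (K f f) (w f) (K e f) (K f e) ⟩
           δ e f * (a e * b f * (w f * K f f)) - (w e * a e) * ((w f * b f) * (K e f * K f e)) ∎) ⟩
    sum (λ e → sum λ f → δ e f * (a e * b f * (w f * K f f)) - (w e * a e) * ((w f * b f) * (K e f * K f e)))
      ≈⟨ trans (sum-cong-≋ λ e → trans
             (sum-- (λ f → δ e f * (a e * b f * (w f * K f f)))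
                    (λ f → (w e * a e) * ((w f * b f) * (K e f * K f e))))
             (+-cong (sum-δ e (λ f → a e * b f * (w f * K f f)))
                     (-‿cong (sym (*-distribˡ-sum (w e * a e) (λ f → (w f * b f) * (K e f * K f e)))))))
           (sum-- (λ e → a e * b e * (w e * K e e)) (λ e → (w e * a e) * sum λ f → (w f * b f) * (K e f * K f e))) ⟩
    sum (λ e → a e * b e * (w e * K e e)) -
    sum (λ e → (w e * a e) * sum λ f → (w f * b f) * (K e f * K f e)) ∎
    where
    first : ∀ a → 𝔼 (degreeSum a) ≈ sum λ e → a e * p e
    first a = trans (𝔼-sum λ e S → a e * 𝟙[ e ∈ S ]) (sum-cong-≋ λ e → 𝔼-* (a e) _)
    second : 𝔼 (λ S → degreeSum a S * degreeSum b S) ≈ sum (λ e → sum λ f → a e * b f * p₂ e f)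
    second = begin
      𝔼 (λ S → degreeSum a S * degreeSum b S)
        ≈⟨ 𝔼-cong′ (λ S → trans (sum-* (λ e → a e * 𝟙[ e ∈ S ]) (λ f → b f * 𝟙[ f ∈ S ]))
             (sum-cong-≋ λ e → sum-cong-≋ λ f →
             solve 4 (λ a x b y → (a :* x) :* (b :* y) := a :* b :* (x :* y)) refl
               (a e) 𝟙[ e ∈ S ] (b f) 𝟙[ f ∈ S ])) ⟩
      𝔼 (λ S → sum λ e → sum λ f → a e * b f * (𝟙[ e ∈ S ] * 𝟙[ f ∈ S ]))
        ≈⟨ 𝔼-sum (λ e S → sum λ f → a e * b f * (𝟙[ e ∈ S ] * 𝟙[ f ∈ S ])) ⟩
      sum (λ e → 𝔼 (λ S → sum λ f → a e * b f * (𝟙[ e ∈ S ] * 𝟙[ f ∈ S ])))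
        ≈⟨ sum-cong-≋ (λ e → trans (𝔼-sum (λ f S → a e * b f * (𝟙[ e ∈ S ] * 𝟙[ f ∈ S ])))
             (sum-cong-≋ λ f → 𝔼-* (a e * b f) _)) ⟩
      sum (λ e → sum λ f → a e * b f * p₂ e f) ∎

-- Laplacian matrices

module LaplacianForm {c ℓ₁ ℓ₂ ℓ₃} (ℝ : RealField c ℓ₁ ℓ₂ ℓ₃) {n} (G : Graph n) where
  open RealField ℝ hiding (zero)
  open RingSolver commutativeRing
  open Sums commutativeRing hiding (sum)
  open Graph G
  open Weighted ℝ G
  open Trees G
  open Flows ℝ G
  open import Relation.Binary.Reasoning.Setoid setoid

  δδ-1 : ∀ {k} (i a j b : Fin k) → i ≡ a → j ≡ b → δ i a * δ j b ≈ 1#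
  δδ-1 i a j b p q =
    trans (*-cong (⟦⟧-true (i ≟ᶠ a) p) (⟦⟧-true (j ≟ᶠ b) q)) (*-identityˡ 1#)

  δδ-0 : ∀ {k} (i a j b : Fin k) → ¬ (i ≡ a × j ≡ b) → δ i a * δ j b ≈ 0#
  δδ-0 i a j b ¬pq with i ≟ᶠ a
  ... | yes p = trans (*-identityˡ _) (⟦⟧-false (j ≟ᶠ b) λ q → ¬pq (p , q))
  ... | no  _ = zeroˡ _

  δ-cong-* : ∀ {k} (i j a : Fin k) → δ i j * δ i a ≈ δ i a * δ j a
  δ-cong-* i j a with i ≟ᶠ j
  ... | no i≢j = trans (zeroˡ _) (sym (δδ-0 i a j a λ (p , q) → i≢j (≡.trans p (≡.sym q))))
  ... | yes ≡.refl with i ≟ᶠ a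
  ...   | yes _ = refl
  ...   | no  _ = trans (zeroʳ 1#) (sym (zeroˡ 0#))

  -- The indicator of `Joins e i j` as a polynomial in δ, which can be summed over vertices;
  -- `loopless` keeps the two products from both being 1.
  joining : Edge → Vertex → Vertex → Carrier
  joining e i j = δ i (head e) * δ j (tail e) + δ i (tail e) * δ j (head e)

  joining-1 : ∀ {e i j} → Joins e i j → joining e i j ≈ 1#
  joining-1 {e} (inj₁ ≡.refl) = trans
    (+-cong (δδ-1 (head e) (head e) (tail e) (tail e) ≡.refl ≡.refl)
            (δδ-0 (head e) (tail e) (tail e) (head e) λ (p , _) →
              loopless e (head e) (inj₁ (≡.cong (head e ,_) (≡.sym p)))))
    (+-identityʳ 1#)
  joining-1 {e} (inj₂ ≡.refl) = trans
    (+-cong (δδ-0 (tail e) (head e) (head e) (tail e) λ (p , _) →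
              loopless e (tail e) (inj₁ (≡.cong (_, tail e) (≡.sym p))))
            (δδ-1 (tail e) (tail e) (head e) (head e) ≡.refl ≡.refl))
    (+-identityˡ 1#)

  joining-0 : ∀ {e i j} → ¬ Joins e i j → joining e i j ≈ 0#
  joining-0 {e} {i} {j} ¬j = trans
    (+-cong (δδ-0 i (head e) j (tail e) λ { (≡.refl , ≡.refl) → ¬j (inj₁ ≡.refl) })
            (δδ-0 i (tail e) j (head e) λ { (≡.refl , ≡.refl) → ¬j (inj₂ ≡.refl) }))
    (+-identityˡ 0#)

  -- By `simple` at most one edge contributes to the sum, namely the one that `any?` finds.
  adjacency-joining : ∀ c i j → adjacency c i j ≈ sum λ e → c e * joining e i j
  adjacency-joining c i j with any? (λ e → joins? e i j)
  ... | yes (e , e-joins) = sym (trans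
    (sum-single e λ f f≢e → trans (*-congˡ (joining-0 {f} λ f-joins → f≢e (simple f-joins e-joins))) (zeroʳ _))
    (trans (*-congˡ (joining-1 e-joins)) (*-identityʳ _)))
  ... | no ¬joins = sym (sum-zero λ e → trans (*-congˡ (joining-0 {e} λ j → ¬joins (e , j))) (zeroʳ _))

  -- The decomposition into rank one matrices c(e) b_e b_eᵀ. The degrees give the products at equal
  -- ends of e, by `δ-cong-*`, and the adjacency gives the mixed products.
  laplacian-∂ : ∀ c i j → laplacian c i j ≈ sum λ e → c e * (∂ (δ i) e * ∂ (δ j) e)
  laplacian-∂ c i j = begin
    (if does (i ≟ᶠ j) then sum (adjacency c i) else 0#) - adjacency c i j
      ≈⟨ +-cong (trans (if-then-0 (does (i ≟ᶠ j)) _) (*-congˡ row-sum)) (-‿cong (adjacency-joining c i j)) ⟩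
    δ i j * sum (λ e → c e * (δ i (head e) + δ i (tail e))) - sum (λ e → c e * joining e i j)
      ≈⟨ +-congʳ (*-distribˡ-sum (δ i j) (λ e → c e * (δ i (head e) + δ i (tail e)))) ⟩
    sum (λ e → δ i j * (c e * (δ i (head e) + δ i (tail e)))) - sum (λ e → c e * joining e i j)
      ≈⟨ sum-- (λ e → δ i j * (c e * (δ i (head e) + δ i (tail e)))) (λ e → c e * joining e i j) ⟨
    sum (λ e → δ i j * (c e * (δ i (head e) + δ i (tail e))) - c e * joining e i j)
      ≈⟨ sum-cong-≋ (λ e → termwise e) ⟩
    sum (λ e → c e * (∂ (δ i) e * ∂ (δ j) e)) ∎
    where
    termwise : ∀ e → δ i j * (c e * (δ i (head e) + δ i (tail e))) - c e * joining e i j ≈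
                     c e * (∂ (δ i) e * ∂ (δ j) e)
    termwise e = begin
      δ i j * (c e * (ih + it)) - c e * (ih * jt + it * jh)
        ≈⟨ solve 7 (λ d c ih it jh jt x → d :* (c :* (ih :+ it)) :- c :* x := c :* (d :* ih :+ d :* it) :- c :* x) refl
             (δ i j) (c e) ih it jh jt _ ⟩
      c e * (δ i j * ih + δ i j * it) - c e * (ih * jt + it * jh)
        ≈⟨ +-congʳ (*-congˡ (+-cong (δ-cong-* i j (head e)) (δ-cong-* i j (tail e)))) ⟩
      c e * (ih * jh + it * jt) - c e * (ih * jt + it * jh)
        ≈⟨ solve 5 (λ c ih it jh jt → c :* (ih :* jh :+ it :* jt) :- c :* (ih :* jt :+ it :* jh)
             := c :* ((ih :- it) :* (jh :- jt))) refl (c e) ih it jh jt ⟩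
      c e * ((ih - it) * (jh - jt)) ∎
      where
      ih = δ i (head e)
      it = δ i (tail e)
      jh = δ j (head e)
      jt = δ j (tail e)

    sum-δ₁ : ∀ x a → sum (λ k → x * δ k a) ≈ x
    sum-δ₁ x a = trans (sum-cong-≋ λ k → trans (*-congˡ (δ-sym k a)) (*-comm x (δ a k))) (sum-δ a (λ _ → x))

    row-sum : sum (adjacency c i) ≈ sum λ e → c e * (δ i (head e) + δ i (tail e))
    row-sum = begin
      sum (adjacency c i)                                ≈⟨ sum-cong-≋ (adjacency-joining c i) ⟩
      sum (λ k → sum λ e → c e * joining e i k)          ≈⟨ ∑-comm (λ k e → c e * joining e i k) ⟩
      sum (λ e → sum λ k → c e * joining e i k)          ≈⟨ sum-cong-≋ (λ e → trans
        (sym (*-distribˡ-sum (c e) (λ k → joining e i k)))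
        (*-congˡ (trans (∑-distrib-+ (λ k → δ i (head e) * δ k (tail e)) (λ k → δ i (tail e) * δ k (head e)))
          (+-cong (sum-δ₁ (δ i (head e)) (tail e)) (sum-δ₁ (δ i (tail e)) (head e)))))) ⟩
      sum (λ e → c e * (δ i (head e) + δ i (tail e)))    ∎

module MatrixAlgebra {c ℓ₁ ℓ₂ ℓ₃} (ℝ : RealField c ℓ₁ ℓ₂ ℓ₃) where
  open RealField ℝ hiding (zero)
  open Sums commutativeRing hiding (sum)
  open Matrices ℝ
  open CommutativeRing commutativeRing using (ring)
  open import Algebra.Properties.Ring ring using ([y-z]x≈yx-zx)
  open import Relation.Binary.Reasoning.Setoid setoid

  Tr-cong : ∀ {n} {M N : Matrix n} → M ≋ N → Tr M ≈ Tr N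
  Tr-cong M≋N = sum-cong-≋ λ i → M≋N i i

  ⊗-cong : ∀ {n} {A A′ B B′ : Matrix n} → A ≋ A′ → B ≋ B′ → A ⊗ B ≋ A′ ⊗ B′
  ⊗-cong A≋A′ B≋B′ i j = sum-cong-≋ λ k → *-cong (A≋A′ i k) (B≋B′ k j)

  ⊗-assoc : ∀ {n} (A B C : Matrix n) → (A ⊗ B) ⊗ C ≋ A ⊗ (B ⊗ C)
  ⊗-assoc A B C i j = begin
    sum (λ k → sum (λ l → A i l * B l k) * C k j)    ≈⟨ sum-cong-≋ (λ k → *-distribʳ-sum (C k j) (λ l → A i l * B l k)) ⟩
    sum (λ k → sum λ l → A i l * B l k * C k j)      ≈⟨ ∑-comm (λ k l → A i l * B l k * C k j) ⟩
    sum (λ l → sum λ k → A i l * B l k * C k j)      ≈⟨ sum-cong-≋ (λ l → trans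
                                                          (sum-cong-≋ λ k → *-assoc (A i l) (B l k) (C k j))
                                                          (sym (*-distribˡ-sum (A i l) (λ k → B l k * C k j)))) ⟩
    sum (λ l → A i l * sum (λ k → B l k * C k j))    ∎

  Tr-⊖-⊗ : ∀ {n} (A B C : Matrix n) → Tr ((A ⊖ B) ⊗ C) ≈ Tr (A ⊗ C) - Tr (B ⊗ C)
  Tr-⊖-⊗ A B C = trans
    (sum-cong-≋ λ i → trans (sum-cong-≋ λ k → [y-z]x≈yx-zx (C k i) (A i k) (B i k))
                            (sum-- (λ k → A i k * C k i) (λ k → B i k * C k i)))
    (sum-- (λ i → sum λ k → A i k * C k i) (λ i → sum λ k → B i k * C k i))

-- The inverse of the reduced Laplacian and the traces

module ReducedLaplacian {c ℓ₁ ℓ₂ ℓ₃} (ℝ : RealField c ℓ₁ ℓ₂ ℓ₃) {n} (G : Graph (suc n))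
  (w : Graph.Edge G → RealField.Carrier ℝ)
  (w>0 : ∀ e → RealField._<_ ℝ (RealField.0# ℝ) (w e)) (r : Graph.Vertex G)
  (P : Weighted.EdgeSet ℝ G → RealField.Carrier ℝ) (law : Weighted.IsSpanningTreeLaw ℝ G w P) where
  open RealField ℝ hiding (zero)
  open RingSolver commutativeRing
  open CommutativeRing commutativeRing using (ring)
  open import Algebra.Properties.Ring ring using (x[y-z]≈xy-xz)
  open Sums commutativeRing hiding (sum)
  open Graph G
  open Weighted ℝ G
  open Moments P
  open Trees G
  open Flows ℝ G
  open LaplacianForm ℝ G
  open MatrixAlgebra ℝ
  open Kirchhoff ℝ G w w>0 r P law
  open import Relation.Binary.Reasoning.Setoid setoid

  ρ : Fin n → Vertex
  ρ = punchIn r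

  b : Edge → Fin n → Carrier
  b e i = ∂ (δ (ρ i)) e

  δ-ρ-r : ∀ i → δ (ρ i) r ≈ 0#
  δ-ρ-r i = ⟦⟧-false (ρ i ≟ᶠ r) (punchInᵢ≢i r i)

  δ-ρ : ∀ i j → δ (ρ i) (ρ j) ≈ δ i j
  δ-ρ i j = ⟦⟧-cong (ρ i ≟ᶠ ρ j) (i ≟ᶠ j) (punchIn-injective r i j) (≡.cong ρ)

  -- The condition `ψ r ≈ 0#` makes up for the deleted index: the values at the vertices other than
  -- r determine ψ everywhere.
  interpolate : ∀ ψ → ψ r ≈ 0# → ∀ v → sum (λ i → ψ (ρ i) * δ (ρ i) v) ≈ ψ v
  interpolate ψ ψr≈0 v with r ≟ᶠ v
  ... | yes ≡.refl = trans (sum-zero λ i → trans (*-congˡ (δ-ρ-r i)) (zeroʳ _)) (sym ψr≈0)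
  ... | no r≢v rewrite ≡.sym (punchIn-punchOut r≢v) = trans
    (sum-cong-≋ λ i → trans (*-comm (ψ (ρ i)) _) (*-congʳ (trans (δ-ρ i j) (δ-sym i j))))
    (sum-δ j (ψ ∘ ρ))
    where j = punchOut r≢v

  interpolate-∂ : ∀ ψ → ψ r ≈ 0# → ∀ e → sum (λ i → ψ (ρ i) * b e i) ≈ ∂ ψ e
  interpolate-∂ ψ ψr≈0 e = trans
    (sum-cong-≋ λ i → x[y-z]≈xy-xz (ψ (ρ i)) (δ (ρ i) (head e)) (δ (ρ i) (tail e)))
    (trans (sum-- (λ i → ψ (ρ i) * δ (ρ i) (head e)) (λ i → ψ (ρ i) * δ (ρ i) (tail e)))
           (+-cong (interpolate ψ ψr≈0 (head e)) (-‿cong (interpolate ψ ψr≈0 (tail e)))))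

  Γ : Matrix n
  Γ i j = green (ρ i) (ρ j)

  L : (Edge → Carrier) → Matrix n
  L c i j = sum λ e → c e * (b e i * b e j)

  laplacian-L : ∀ {a c} → (∀ e → a e ≈ c e) → laplacian a [ r ] ≋ L c
  laplacian-L a≈c i j = trans (laplacian-∂ _ (ρ i) (ρ j)) (sum-cong-≋ λ e → *-congʳ (a≈c e))

  ⊗-green : ∀ c i j → (L c ⊗ Γ) i j ≈ sum λ e → c e * b e i * ∂ (green (ρ j)) e
  ⊗-green c i j = begin
    sum (λ k → sum (λ e → c e * (b e i * b e k)) * Γ k j)
      ≈⟨ sum-cong-≋ (λ k → *-distribʳ-sum (Γ k j) (λ e → c e * (b e i * b e k))) ⟩
    sum (λ k → sum λ e → c e * (b e i * b e k) * Γ k j)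
      ≈⟨ ∑-comm (λ k e → c e * (b e i * b e k) * Γ k j) ⟩
    sum (λ e → sum λ k → c e * (b e i * b e k) * Γ k j)
      ≈⟨ sum-cong-≋ (λ e → trans
           (sum-cong-≋ λ k → trans (*-congˡ (green-sym (ρ k) (ρ j)))
             (solve 4 (λ c x y g → c :* (x :* y) :* g := c :* x :* (g :* y)) refl
               (c e) (b e i) (b e k) (green (ρ j) (ρ k))))
           (trans (sym (*-distribˡ-sum (c e * b e i) (λ k → green (ρ j) (ρ k) * b e k)))
                  (*-congˡ (interpolate-∂ (green (ρ j)) (green-r (ρ j)) e)))) ⟩
    sum (λ e → c e * b e i * ∂ (green (ρ j)) e) ∎

  -- Row i of the reduced Laplacian is the energy against the indicator of `ρ i`, so the entries
  -- come from the reproducing property.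
  inverseʳ : L w ⊗ Γ ≋ identity
  inverseʳ i j = begin
    (L w ⊗ Γ) i j                                   ≈⟨ ⊗-green w i j ⟩
    sum (λ e → w e * b e i * ∂ (green (ρ j)) e)     ≈⟨ sum-cong-≋ (λ e → trans (*-assoc (w e) (b e i) (∂ (green (ρ j)) e))
                                                         (*-congˡ (*-comm (b e i) (∂ (green (ρ j)) e)))) ⟩
    energy (green (ρ j)) (δ (ρ i))                  ≈⟨ energy-green (ρ j) (δ (ρ i)) ⟩
    δ (ρ i) (ρ j) - δ (ρ i) r                       ≈⟨ x-0≈x (δ-ρ-r i) ⟩
    δ (ρ i) (ρ j)                                   ≈⟨ δ-ρ i j ⟩
    identity i j                                    ∎

  -- Both factors are symmetric, so this is `inverseʳ` transposed.
  inverseˡ : Γ ⊗ L w ≋ identity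
  inverseˡ i j = begin
    sum (λ k → Γ i k * L w k j)     ≈⟨ sum-cong-≋ (λ k → trans (*-comm (Γ i k) (L w k j))
                                         (*-cong (sum-cong-≋ λ e → *-congˡ (*-comm (b e k) (b e j))) (green-sym (ρ i) (ρ k)))) ⟩
    (L w ⊗ Γ) j i                   ≈⟨ inverseʳ j i ⟩
    δ j i                           ≈⟨ δ-sym j i ⟩
    δ i j                           ∎

  Γ-inverse : IsInverse (laplacian w [ r ]) Γ
  Γ-inverse =
      (λ i j → trans (⊗-cong {B = Γ} {Γ} (laplacian-L λ _ → refl) (λ _ _ → refl) i j) (inverseʳ i j))
    , (λ i j → trans (⊗-cong {A = Γ} {Γ} (λ _ _ → refl) (laplacian-L λ _ → refl) i j) (inverseˡ i j))

  interpolate-K : ∀ e f → sum (λ i → b e i * ∂ (green (ρ i)) f) ≈ K e f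
  interpolate-K e f = trans
    (trans (sum-cong-≋ λ i → *-comm (b e i) (∂ (green (ρ i)) f))
           (interpolate-∂ (λ v → ∂ (green v) f) (x-x≈0 ∂green-r) e))
    (K-sym f e)
    where
    ∂green-r : green r (head f) ≈ green r (tail f)
    ∂green-r = trans (trans (green-sym r (head f)) (green-r (head f)))
                     (sym (trans (green-sym r (tail f)) (green-r (tail f))))

  Tr-LΓ : ∀ c → Tr (L c ⊗ Γ) ≈ sum λ e → c e * K e e
  Tr-LΓ c = begin
    sum (λ i → (L c ⊗ Γ) i i)                                ≈⟨ sum-cong-≋ (λ i → ⊗-green c i i) ⟩
    sum (λ i → sum λ e → c e * b e i * ∂ (green (ρ i)) e)    ≈⟨ ∑-comm (λ i e → c e * b e i * ∂ (green (ρ i)) e) ⟩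
    sum (λ e → sum λ i → c e * b e i * ∂ (green (ρ i)) e)    ≈⟨ sum-cong-≋ (λ e → trans
        (sum-cong-≋ λ i → *-assoc (c e) (b e i) (∂ (green (ρ i)) e))
        (trans (sym (*-distribˡ-sum (c e) (λ i → b e i * ∂ (green (ρ i)) e)))
               (*-congˡ (interpolate-K e e)))) ⟩
    sum (λ e → c e * K e e)                                  ∎

  -- In rank one form the matrix is a sum of a(e) c(f) b_e b_eᵀ Γ b_f b_fᵀ Γ, each with a trace that
  -- is a product of two scalars. The sums over i and k are moved inside because the summand factors
  -- there.
  Tr-LΓLΓ : ∀ a c → Tr (L a ⊗ Γ ⊗ L c ⊗ Γ) ≈ sum λ e → a e * sum λ f → c f * (K e f * K f e)
  Tr-LΓLΓ a c = begin
    Tr (L a ⊗ Γ ⊗ L c ⊗ Γ)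
      ≈⟨ Tr-cong (⊗-assoc (L a ⊗ Γ) (L c) Γ) ⟩
    sum (λ i → sum λ k → (L a ⊗ Γ) i k * (L c ⊗ Γ) k i)
      ≈⟨ sum-cong-≋ (λ i → sum-cong-≋ λ k → trans (*-cong (⊗-green a i k) (⊗-green c k i))
           (sum-* (λ e → a e * b e i * ∂ (green (ρ k)) e) (λ f → c f * b f k * ∂ (green (ρ i)) f))) ⟩
    sum (λ i → sum λ k → sum λ e → sum λ f → X i k e f)
      ≈⟨ sum-cong-≋ (λ i → trans (∑-comm (λ k e → sum λ f → X i k e f))
           (sum-cong-≋ λ e → ∑-comm (λ k f → X i k e f))) ⟩
    sum (λ i → sum λ e → sum λ f → sum λ k → X i k e f)
      ≈⟨ trans (∑-comm (λ i e → sum λ f → sum λ k → X i k e f))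
           (sum-cong-≋ λ e → ∑-comm (λ i f → sum λ k → X i k e f)) ⟩
    sum (λ e → sum λ f → sum λ i → sum λ k → X i k e f)
      ≈⟨ sum-cong-≋ (λ e → sum-cong-≋ λ f → begin
           sum (λ i → sum λ k → X i k e f)
             ≈⟨ sum-cong-≋ (λ i → sum-cong-≋ λ k →
                  solve 6 (λ a x g c y h → a :* x :* g :* (c :* y :* h) := (a :* c :* (x :* h)) :* (y :* g)) refl
                    (a e) (b e i) (∂ (green (ρ k)) e) (c f) (b f k) (∂ (green (ρ i)) f)) ⟩
           sum (λ i → sum λ k → a e * c f * (b e i * ∂ (green (ρ i)) f) * (b f k * ∂ (green (ρ k)) e))
             ≈⟨ sum-* (λ i → a e * c f * (b e i * ∂ (green (ρ i)) f)) (λ k → b f k * ∂ (green (ρ k)) e) ⟨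
           sum (λ i → a e * c f * (b e i * ∂ (green (ρ i)) f)) * sum (λ k → b f k * ∂ (green (ρ k)) e)
             ≈⟨ *-cong (trans (sym (*-distribˡ-sum (a e * c f) (λ i → b e i * ∂ (green (ρ i)) f)))
                              (*-congˡ (interpolate-K e f))) (interpolate-K f e) ⟩
           a e * c f * K e f * K f e
             ≈⟨ solve 4 (λ a c x y → a :* c :* x :* y := a :* (c :* (x :* y))) refl (a e) (c f) (K e f) (K f e) ⟩
           a e * (c f * (K e f * K f e)) ∎) ⟩
    sum (λ e → sum λ f → a e * (c f * (K e f * K f e)))
      ≈⟨ sum-cong-≋ (λ e → *-distribˡ-sum (a e) (λ f → c f * (K e f * K f e))) ⟨
    sum (λ e → a e * sum λ f → c f * (K e f * K f e)) ∎
    where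
    X : Fin n → Fin n → Edge → Edge → Carrier
    X i k e f = a e * b e i * ∂ (green (ρ k)) e * (c f * b f k * ∂ (green (ρ i)) f)

  -- Serves variance and covariance alike. The weights enter up to pointwise equality because the
  -- Laplacians of the theorem select edges by `if_then_else_`.
  Cov-trace : ∀ {X Z} a d {l₁ l₁′ l₂} →
    (∀ S → X S ≈ degreeSum a S) → (∀ S → Z S ≈ degreeSum d S) →
    (∀ e → l₁ e ≈ w e * a e) → (∀ e → l₁′ e ≈ w e * d e) → (∀ e → l₂ e ≈ w e * (a e * d e)) →
    let M₁ = laplacian l₁ [ r ] ; M₁′ = laplacian l₁′ [ r ] ; M₂ = laplacian l₂ [ r ] in
    Cov X Z ≈ Tr ((M₂ ⊖ M₁ ⊗ Γ ⊗ M₁′) ⊗ Γ)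
  Cov-trace {X} {Z} a d {l₁} {l₁′} {l₂} X≈ Z≈ l₁≈ l₁′≈ l₂≈ = begin
    Cov X Z
      ≈⟨ 𝔼-cong-Cov X≈ Z≈ ⟩
    Cov (degreeSum a) (degreeSum d)
      ≈⟨ Cov-degreeSum a d ⟩
    sum (λ e → a e * d e * (w e * K e e)) -
    sum (λ e → (w e * a e) * sum λ f → (w f * d f) * (K e f * K f e))
      ≈⟨ +-cong (trans (sum-cong-≋ λ e → solve 4 (λ a d w k → a :* d :* (w :* k) := (w :* (a :* d)) :* k) refl
                                           (a e) (d e) (w e) (K e e)) (sym (Tr-LΓ (λ e → w e * (a e * d e)))))
                (-‿cong (sym (Tr-LΓLΓ (λ e → w e * a e) (λ e → w e * d e)))) ⟩
    Tr (L (λ e → w e * (a e * d e)) ⊗ Γ) - Tr (L (λ e → w e * a e) ⊗ Γ ⊗ L (λ e → w e * d e) ⊗ Γ)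
      ≈⟨ +-cong (Tr-cong (⊗-cong M₂≋ Γ≋)) (-‿cong (Tr-cong (⊗-cong (⊗-cong (⊗-cong M₁≋ Γ≋) M₁′≋) Γ≋))) ⟩
    Tr (M₂ ⊗ Γ) - Tr (M₁ ⊗ Γ ⊗ M₁′ ⊗ Γ)
      ≈⟨ Tr-⊖-⊗ M₂ (M₁ ⊗ Γ ⊗ M₁′) Γ ⟨
    Tr ((M₂ ⊖ M₁ ⊗ Γ ⊗ M₁′) ⊗ Γ) ∎
    where
    M₁ = laplacian l₁ [ r ]
    M₁′ = laplacian l₁′ [ r ]
    M₂ = laplacian l₂ [ r ]
    Γ≋ : Γ ≋ Γ
    Γ≋ _ _ = refl
    M₁≋ : L (λ e → w e * a e) ≋ M₁
    M₁≋ i j = sym (laplacian-L l₁≈ i j)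
    M₁′≋ : L (λ e → w e * d e) ≋ M₁′
    M₁′≋ i j = sym (laplacian-L l₁′≈ i j)
    M₂≋ : L (λ e → w e * (a e * d e)) ≋ M₂
    M₂≋ i j = sym (laplacian-L l₂≈ i j)

  module _ (ω : Edge → Carrier) where

    at : Vertex → Edge → Carrier
    at v e = ⟦ does (incident? v e) ⟧ * ω e

    degree-degreeSum : ∀ v S → degree ω v S ≈ degreeSum (at v) S
    degree-degreeSum v S = sum-cong-≋ λ e → termwise (does (e ∈? S)) (does (incident? v e)) (ω e)
      where
      termwise : ∀ p q x → (if p ∧ q then x else 0#) ≈ ⟦ q ⟧ * x * ⟦ p ⟧
      termwise true  q x = trans (if-then-0 q x) (sym (*-identityʳ _))
      termwise false q x = sym (zeroʳ _)

    weight₁ : ∀ v e → (if does (incident? v e) then w e * ω e ^ 1 else 0#) ≈ w e * at v e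
    weight₁ v e = trans (if-then-0 (does (incident? v e)) _)
      (trans (*-congˡ (*-congˡ (*-identityʳ (ω e))))
             (solve 3 (λ i w x → i :* (w :* x) := w :* (i :* x)) refl _ (w e) (ω e)))

    -- The test `q` is incidence with v for the variance and joining v to u for the covariance.
    weight₂ : ∀ v u e q → ⟦ q ⟧ ≈ ⟦ does (incident? v e) ⟧ * ⟦ does (incident? u e) ⟧ →
              (if q then w e * ω e ^ 2 else 0#) ≈ w e * (at v e * at u e)
    weight₂ v u e q eq = trans (if-then-0 q _)
      (trans (*-cong eq (*-congˡ (*-congˡ (*-identityʳ (ω e)))))
             (solve 4 (λ i j w x → i :* j :* (w :* (x :* x)) := w :* (i :* x :* (j :* x))) refl _ _ (w e) (ω e)))

    idempotent : ∀ q → ⟦ q ⟧ ≈ ⟦ q ⟧ * ⟦ q ⟧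
    idempotent true  = sym (*-identityˡ 1#)
    idempotent false = sym (zeroˡ 0#)

    -- Two distinct vertices on e are its two ends; hence only the edge vu enters the first term of
    -- the covariance.
    common-edge : ∀ {v u} → u ≢ v → ∀ e →
      ⟦ does (joins? e v u) ⟧ ≈ ⟦ does (incident? v e) ⟧ * ⟦ does (incident? u e) ⟧
    common-edge {v} {u} u≢v e = ⟦⟧-× (incident? v e) (incident? u e) (joins? e v u) join
      λ { (inj₁ ≡.refl) → inj₁ ≡.refl , inj₂ ≡.refl ; (inj₂ ≡.refl) → inj₂ ≡.refl , inj₁ ≡.refl }
      where
      join : Incident v e → Incident u e → Joins e v u
      join (inj₁ ≡.refl) (inj₁ u≡v)    = ⊥-elim (u≢v u≡v)
      join (inj₁ ≡.refl) (inj₂ ≡.refl) = inj₁ ≡.refl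
      join (inj₂ ≡.refl) (inj₁ ≡.refl) = inj₂ ≡.refl
      join (inj₂ ≡.refl) (inj₂ u≡v)    = ⊥-elim (u≢v u≡v)

    𝔼-degree : ∀ v → 𝔼 (degree ω v) ≈ Tr (vertexLaplacian w ω 1 v [ r ] ⊗ Γ)
    𝔼-degree v = begin
      𝔼 (degree ω v)                                ≈⟨ 𝔼-cong′ (degree-degreeSum v) ⟩
      𝔼 (degreeSum (at v))                          ≈⟨ 𝔼-degreeSum (at v) ⟩
      sum (λ e → at v e * (w e * K e e))            ≈⟨ sum-cong-≋ (λ e →
        solve 3 (λ a w k → a :* (w :* k) := w :* a :* k) refl (at v e) (w e) (K e e)) ⟩
      sum (λ e → w e * at v e * K e e)              ≈⟨ Tr-LΓ (λ e → w e * at v e) ⟨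
      Tr (L (λ e → w e * at v e) ⊗ Γ)               ≈⟨ Tr-cong (⊗-cong {B = Γ} {Γ} (laplacian-L (weight₁ v)) (λ _ _ → refl)) ⟨
      Tr (vertexLaplacian w ω 1 v [ r ] ⊗ Γ)        ∎

    Var-degree : ∀ v → let L₁ = vertexLaplacian w ω 1 v [ r ] ; L₂ = vertexLaplacian w ω 2 v [ r ] in
      Var (degree ω v) ≈ Tr ((L₂ ⊖ L₁ ⊗ Γ ⊗ L₁) ⊗ Γ)
    -- The square unfolds to `x * (x * 1#)`, which makes the variance the covariance of the degree
    -- with itself.
    Var-degree v = trans (𝔼-cong′ λ S → *-congˡ (*-identityʳ _))
      (Cov-trace (at v) (at v) (degree-degreeSum v) (degree-degreeSum v) (weight₁ v) (weight₁ v)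
        (λ e → weight₂ v v e (does (incident? v e)) (idempotent (does (incident? v e)))))

    Cov-degree : ∀ v u → u ≢ v →
      let L₁ = λ v → vertexLaplacian w ω 1 v [ r ] ; L₂ = pairLaplacian w ω v u [ r ] in
      Cov (degree ω v) (degree ω u) ≈ Tr ((L₂ ⊖ L₁ v ⊗ Γ ⊗ L₁ u) ⊗ Γ)
    Cov-degree v u u≢v =
      Cov-trace (at v) (at u) (degree-degreeSum v) (degree-degreeSum u) (weight₁ v) (weight₁ u)
        (λ e → weight₂ v u e (does (joins? e v u)) (common-edge u≢v e))

theorem3 :
    ∀ {c ℓ₁ ℓ₂ ℓ₃} (ℝ : RealField c ℓ₁ ℓ₂ ℓ₃) {n : ℕ} (G : Graph (suc n)) →
    let open RealField ℝ
        open Graph G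
        open Weighted ℝ G
    in
    Connected →
    (w : Edge → Carrier) → (∀ e → 0# < w e) →
    (ω : Edge → Carrier) →
    (r : Vertex) →
    (P : EdgeSet → Carrier) → IsSpanningTreeLaw w P →
    let open Moments P
        L₁ = λ v → vertexLaplacian w ω 1 v [ r ]
        L₂ = λ v → vertexLaplacian w ω 2 v [ r ]
        L₂′ = λ v u → pairLaplacian w ω v u [ r ]
        deg = degree ω
    in
    Σ[ L⁻¹ ∈ Matrix n ] IsInverse (laplacian w [ r ]) L⁻¹ ×
      (∀ (v : Vertex) →
        (𝔼 (deg v) ≈ Tr (L₁ v ⊗ L⁻¹)) ×
        (Var (deg v) ≈ Tr ((L₂ v ⊖ L₁ v ⊗ L⁻¹ ⊗ L₁ v) ⊗ L⁻¹)) ×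
        (∀ (u : Vertex) → u ≢ v →
          Cov (deg v) (deg u) ≈ Tr ((L₂′ v u ⊖ L₁ v ⊗ L⁻¹ ⊗ L₁ u) ⊗ L⁻¹)))
theorem3 ℝ G connected w w>0 ω r P law =
  Γ , Γ-inverse , λ v → 𝔼-degree ω v , Var-degree ω v , Cov-degree ω v
  where open ReducedLaplacian ℝ G w w>0 r P law
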